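{- There exists an absolute constant $C>0$ such that for every positive integer $n$ and every $\varepsilon\in(0,1/3)$, $$\operatorname{P-deg}_\varepsilon(\mathrm{OR}_n)\;\le\;\operatorname{hcP-deg}_\varepsilon(\mathrm{OR}_n)\;\le\; C\cdot\log\binom{n}{\le\log(1/\varepsilon)} .$$
   Context: All logarithms are to base 2. For a positive integer $N$ and real $\alpha\ge 0$, $\binom{N}{\le\alpha}:=\sum_{i\in\mathbb{Z},\,0\le i\le\alpha}\binom{N}{i}$, with $\binom{N}{i}=0$ if $i>N$. $\mathrm{OR}_n:\{0,1\}^n\to\{0,1\}$ is the function with $\mathrm{OR}_n(x)=0$ iff $x=0^n$. For $f:\{0,1\}^n\to\{0,1\}$, an $\varepsilon$-error probabilistic polynomial for $f$ is a probability distribution $\mathbf{P}$ on polynomials in $\mathbb{R}[x_1,\dots,x_n]$ such that for every $x\in\{0,1\}^n$, $\Pr_{P\sim\mathbf{P}}[P(x)\ne f(x)]\le\varepsilon$. The $\varepsilon$-error probabilistic degree $\operatorname{P-deg}_\varepsilon(f)$ is the smallest non-negative integer $d$ such that there is an $\varepsilon$-error probabilistic polynomial for $f$ supported entirely on polynomials of degree at most $d$. A linear form is a homogeneous degree-one polynomial $L(x)=a_1x_1+\dots+a_nx_n$ with $a_i\in\mathbb{R}$ (the zero form is allowed). A polynomial $P\in\mathbb{R}[x_1,\dots,x_n]$ is a hyperplane covering polynomial of degree $t$ if there exist $t$ linear forms $L_1,\dots,L_t$ over $\mathbb{R}$ such that $P(x)=1-\prod_{i=1}^t(1-L_i(x))$.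 The $\varepsilon$-error hyperplane covering probabilistic degree $\operatorname{hcP-deg}_\varepsilon(f)$ is the smallest non-negative integer $d$ such that there is an $\varepsilon$-error probabilistic polynomial for $f$ supported entirely on hyperplane covering polynomials of degree at most $d$. -}

module Defs where

open import Algebra.Bundles using (CommutativeRing; Semiring)
open import Algebra.Structures using (IsCommutativeRing)
open import Data.Bool.Base using (Bool; true; false; _∨_)
open import Data.Fin.Base using (Fin; toℕ)
open import Data.List.Base as List using (List; []; _∷_)
open import Data.Nat.Base as ℕ using (ℕ; suc)
open import Data.Nat.Combinatorics using (_C_)
import Data.Nat.ListAction as ℕ-List
import Data.Nat.Properties as ℕ
open import Data.Product.Base using (Σ; ∃; _×_; _,_; proj₁; proj₂; map₁)
open import Data.Vec.Base as Vec using (Vec)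
open import Data.Vec.Properties using (≡-dec)
open import Level using (0ℓ)
open import Relation.Binary.Core using (Rel)
import Relation.Binary.Construct.NonStrictToStrict as NonStrictToStrict
open import Relation.Binary.PropositionalEquality.Core using (_≢_)
open import Relation.Binary.Structures using (IsDecTotalOrder)
open import Relation.Nullary.Negation.Core using (¬_)
open import Relation.Unary using (Pred; U; ∁; ⋃; _⊆_; _≐_; _∩_; Empty; Satisfiable)

-- The real numbers, axiomatised up to isomorphism as a Dedekind-complete
-- ordered field with the order decidable, as it is classically.  Equality is a
-- setoid equality.  The operations _⁻¹ and sup are total; their values are
-- unspecified at 0# and at empty or unbounded sets respectively.
record Reals : Set₁ where
  infix  4 _≈_ _≤_
  infixl 6 _+_
  infixl 7 _*_
  infix  8 -_
  infix  9 _⁻¹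
  field
    Carrier : Set
    _≈_ _≤_ : Rel Carrier 0ℓ
    _+_ _*_ : Carrier → Carrier → Carrier
    -_ _⁻¹  : Carrier → Carrier
    0# 1#   : Carrier
    sup     : Pred Carrier 0ℓ → Carrier

  UpperBound : Pred Carrier 0ℓ → Pred Carrier 0ℓ
  UpperBound A u = ∀ {x} → A x → x ≤ u

  IsLUB : Pred Carrier 0ℓ → Pred Carrier 0ℓ
  IsLUB A s = UpperBound A s × (∀ {u} → UpperBound A u → s ≤ u)

  field
    isCommutativeRing : IsCommutativeRing _≈_ _+_ _*_ -_ 0# 1#
    isDecTotalOrder   : IsDecTotalOrder _≈_ _≤_
    0≉1               : ¬ (0# ≈ 1#)
    ⁻¹-inverseʳ       : ∀ {x} → ¬ (x ≈ 0#) → x * x ⁻¹ ≈ 1#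
    +-monoˡ-≤         : ∀ {x y} z → x ≤ y → x + z ≤ y + z
    *-nonNeg          : ∀ {x y} → 0# ≤ x → 0# ≤ y → 0# ≤ x * y
    sup-isLUB         : ∀ A → Satisfiable A → Satisfiable (UpperBound A) → IsLUB A (sup A)

  commutativeRing : CommutativeRing 0ℓ 0ℓ
  commutativeRing = record { isCommutativeRing = isCommutativeRing }

  open CommutativeRing commutativeRing public
    using (semiring; _-_; _≉_)
  open import Algebra.Definitions.RawSemiring (Semiring.rawSemiring semiring) public
    using (_^_; sum)
    renaming (_×_ to _·_)
  open IsDecTotalOrder isDecTotalOrder public
    using (_≟_; _≤?_)
  open NonStrictToStrict _≈_ _≤_ public
    using (_<_)

  fromℕ : ℕ → Carrier
  fromℕ k = k · 1#

  fromBool : Bool → Carrier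
  fromBool false = 0#
  fromBool true  = 1#

  -- log₂ y is the supremum of the rationals r = (a - b) / q with 2 ^ r ≤ y;
  -- both conditions are written free of division.  Meaningful for 0# < y.
  log₂ : Carrier → Carrier
  log₂ y = sup λ r → ∃ λ a → ∃ λ b → ∃ λ q →
    ℕ.NonZero q ×
    fromℕ q * r ≈ fromℕ a - fromℕ b ×
    fromℕ 2 ^ a ≤ fromℕ 2 ^ b * y ^ q

BooleanFunction : ℕ → Set
BooleanFunction n = Vec Bool n → Bool

OR : ∀ {n} → BooleanFunction n
OR = Vec.foldr′ _∨_ false

IsLeast : Pred ℕ (Level.suc 0ℓ) → Pred ℕ (Level.suc 0ℓ)
IsLeast Q d = Q d × (∀ e → Q e → d ℕ.≤ e)

module Over (ℝ : Reals) where
  open Reals ℝ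

  -- The sum of the binomial coefficients N C i over 0 ≤ i ≤ α; indices i > N
  -- contribute nothing and are left out.
  binom≤ : ℕ → Carrier → ℕ
  binom≤ N α = ℕ-List.sum
    (List.map (N C_) (List.filter (λ i → fromℕ i ≤? α) (List.upTo (suc N))))

  -- Elements of ℝ[x₁,…,xₙ] are represented by finite lists of terms
  -- (coefficient , exponent vector), in which exponent vectors may be repeated.
  -- Equality of polynomials is _≈ₚ_, equality of all coefficients.
  Poly : ℕ → Set
  Poly n = List (Carrier × Vec ℕ n)

  module _ {n : ℕ} where

    infix  4 _≈ₚ_
    infixl 6 _-ₚ_
    infixl 7 _*ₚ_

    coeff : Poly n → Vec ℕ n → Carrier
    coeff P m = List.foldr _+_ 0#
      (List.map proj₁ (List.filter (λ t → ≡-dec ℕ._≟_ (proj₂ t) m) P))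

    _≈ₚ_ : Rel (Poly n) 0ℓ
    P ≈ₚ Q = ∀ m → coeff P m ≈ coeff Q m

    1ₚ : Poly n
    1ₚ = (1# , Vec.replicate n 0) ∷ []

    _-ₚ_ : Poly n → Poly n → Poly n
    P -ₚ Q = P List.++ List.map (map₁ λ a → - a) Q

    _*ₚ_ : Poly n → Poly n → Poly n
    _*ₚ_ = List.cartesianProductWith
      λ { (a , k) (b , l) → a * b , Vec.zipWith ℕ._+_ k l }

    eval : Poly n → Vec Carrier n → Carrier
    eval P x = List.foldr _+_ 0#
      (List.map (λ { (a , m) → a * Vec.foldr′ _*_ 1# (Vec.zipWith _^_ x m) }) P)

    DegreeAtMost : ℕ → Pred (Poly n) 0ℓ
    DegreeAtMost d P = ∀ m → coeff P m ≉ 0# → Vec.sum m ℕ.≤ d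

    -- The linear form with coefficient vector a.
    linearForm : Vec Carrier n → Poly n
    linearForm a = Vec.toList (Vec.tabulate λ i →
      Vec.lookup a i , (Vec.replicate n 0 Vec.[ i ]≔ 1))

    IsHyperplaneCovering : ℕ → Pred (Poly n) 0ℓ
    IsHyperplaneCovering t P = ∃ λ (a : Vec (Vec Carrier n) t) →
      P ≈ₚ 1ₚ -ₚ Vec.foldr′ _*ₚ_ 1ₚ (Vec.map (λ aᵢ → 1ₚ -ₚ linearForm aᵢ) a)

    HyperplaneCoveringAtMost : ℕ → Pred (Poly n) 0ℓ
    HyperplaneCoveringAtMost d P = ∃ λ t → t ℕ.≤ d × IsHyperplaneCovering t P

  -- A probability measure on an arbitrary σ-algebra of subsets of Ω.  Values of
  -- Pr at non-measurable sets carry no meaning.  The terms of the series in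
  -- σ-additive are non-negative, so its sum is the least upper bound of its
  -- partial sums.
  record ProbabilityMeasure (Ω : Set) : Set₁ where
    field
      Measurable      : Pred Ω 0ℓ → Set
      measurable-resp : ∀ {A B} → A ≐ B → Measurable A → Measurable B
      measurable-U    : Measurable U
      measurable-∁    : ∀ {A} → Measurable A → Measurable (∁ A)
      measurable-⋃    : ∀ {A : ℕ → Pred Ω 0ℓ} → (∀ k → Measurable (A k)) → Measurable (⋃ ℕ A)

      Pr         : Pred Ω 0ℓ → Carrier
      Pr-cong    : ∀ {A B} → Measurable A → A ≐ B → Pr A ≈ Pr B
      Pr-nonNeg  : ∀ {A} → Measurable A → 0# ≤ Pr A
      Pr-U       : Pr U ≈ 1#
      σ-additive : ∀ {A : ℕ → Pred Ω 0ℓ} → (∀ k → Measurable (A k)) →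
                   (∀ {j k} → j ≢ k → Empty (A j ∩ A k)) →
                   IsLUB (λ s → ∃ λ m → s ≈ sum (λ (k : Fin m) → Pr (A (toℕ k))))
                         (Pr (⋃ ℕ A))

    -- Some event of probability one lies within S; S itself need not be
    -- measurable.
    SupportedOn : Pred Ω 0ℓ → Set₁
    SupportedOn S = Σ (Pred Ω 0ℓ) λ A → Measurable A × A ⊆ S × Pr A ≈ 1#

  open ProbabilityMeasure using (Measurable; Pr; SupportedOn)

  module _ {n : ℕ} (ε : Carrier) (f : BooleanFunction n) where

    ErrorAt : Vec Bool n → Pred (Poly n) 0ℓ
    ErrorAt x P = eval P (Vec.map fromBool x) ≉ fromBool (f x)

    -- A distribution on representatives of polynomials; the events that matter
    -- depend only on the polynomial represented.
    IsProbabilisticPolynomial : Pred (ProbabilityMeasure (Poly n)) 0ℓ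
    IsProbabilisticPolynomial 𝐏 =
      ∀ x → Measurable 𝐏 (ErrorAt x) × Pr 𝐏 (ErrorAt x) ≤ ε

    IsPDeg : Pred ℕ (Level.suc 0ℓ)
    IsPDeg = IsLeast λ d → Σ (ProbabilityMeasure (Poly n)) λ 𝐏 →
      IsProbabilisticPolynomial 𝐏 × SupportedOn 𝐏 (DegreeAtMost d)

    IsHCPDeg : Pred ℕ (Level.suc 0ℓ)
    IsHCPDeg = IsLeast λ d → Σ (ProbabilityMeasure (Poly n)) λ 𝐏 →
      IsProbabilisticPolynomial 𝐏 × SupportedOn 𝐏 (HyperplaneCoveringAtMost d)

-- Let K be least with 2^-K ≤ ε, and suppose that k := K - 1 < n.  The forms
-- (x₁ + … + xₙ)/j for 1 ≤ j ≤ k take the value 1 at every point of weight at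
-- most k.  For a weight w > k with k 2^i ≤ w < k 2^(i+1), the sum of a random
-- set of variables of density 1/(k 2^(i+2)) takes the value 1 with probability
-- at least 1/8, so 7K independent such sums for this i all fail with probability
-- at most 2^-K.  There are O(log (n/k)) values of i to cover, hence
-- O(k log (n/k)) forms in all, and this is O(log (n choose ≤k)) because
-- (n choose ≤k) ≥ (q + 1)^k whenever kq ≤ n.  For k ≥ n the n forms
-- (x₁ + … + xₙ)/j suffice.

module Submission where

open import Defs
open import Algebra.Bundles using (CommutativeRing)
open import Axiom.ExcludedMiddle using (ExcludedMiddle)
open import Data.Bool.Base using (Bool; true; false; if_then_else_)
open import Data.Fin.Base using (Fin; toℕ; zero; suc)
open import Data.List.Base as List using (List; []; _∷_; _++_)
import Data.List.Properties as List
open import Data.List.Relation.Unary.All as All using (All; []; _∷_)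
import Data.List.Relation.Unary.All.Properties as All
open import Data.Nat.Base as ℕ using (ℕ; zero; suc; NonZero)
open import Data.Nat.Combinatorics using (_C_; nCk+nC[k+1]≡[n+1]C[k+1])
open import Data.Nat.ListAction as ℕ-List using (product)
import Data.Nat.ListAction.Properties as ℕ-List
import Data.Nat.Properties as ℕ
open import Data.Nat.Tactic.RingSolver using (solve-∀)
open import Data.Product.Base using (Σ; ∃; _×_; _,_; proj₁; proj₂; map₁)
open import Data.Sum.Base using (_⊎_; inj₁; inj₂; [_,_]′)
open import Data.Vec.Base as Vec using (Vec; []; _∷_)
open import Data.Vec.Relation.Unary.All as VecAll using ()
open import Data.Vec.Properties using (≡-dec)
open import Data.Unit.Base using (⊤)
open import Function.Base using (_∘_; id)
open import Level using (0ℓ; Lift; lift; lower)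
open import Relation.Binary.Bundles using (Poset)
open import Relation.Binary.Structures using (IsDecTotalOrder)
open import Relation.Binary.PropositionalEquality as ≡ using (_≡_; _≢_; refl; cong; cong₂; subst)
open import Relation.Nullary using (Dec; yes; no; does; ¬_; contradiction)
import Relation.Nullary.Decidable as Dec
open import Relation.Unary using (Pred; Decidable; U; ∁; ⋃; _⊆_; _∩_; _∪_; Empty)

-- Linear forms vanish at the zero input, so a covering polynomial never errs there; at any other
-- input one form of value 1 kills the product. Only the event that every form misses 1 has to be
-- made rare. Random sums at all scales from 1 to n would cost about K log n, which is too much when
-- k is proportional to n: then log (n choose ≤k) is only O(n). One fixed form for each weight up to
-- k costs k in total and leaves only the scales between k and n. The probability 1/8 arises as 1/2
-- times 1/4: a union bound leaves all marked coordinates unhit with probability at least 1/2, and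
-- exactly one hit is at least 1/4 as likely as none. The binomial sum is truncated at k and not at
-- K because 2^k ≤ 1/ε gives k ≤ log (1/ε). Since ε < 1/3 forces k ≥ 1, nothing is lost: K = k + 1 ≤
-- 2k. All randomness is a uniform draw from a finite list, so every probability estimate is an
-- inequality between products of natural numbers.

least : ∀ {ℓ} {Q : Pred ℕ ℓ} → Decidable Q → ∀ {d} → Q d →
        ∃ λ m → Q m × (∀ e → Q e → m ℕ.≤ e)
least {Q = Q} Q? {d} Qd = [ id , (λ none → contradiction Qd (none d ℕ.≤-refl)) ]′ (search (suc d))
  where
  search : ∀ b → (∃ λ m → Q m × (∀ e → Q e → m ℕ.≤ e)) ⊎ (∀ e → e ℕ.< b → ¬ Q e)
  search zero = inj₂ λ _ ()
  search (suc b) with search b | Q? b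
  ... | inj₁ found | _      = inj₁ found
  ... | inj₂ none  | yes Qb = inj₁ (b , Qb , λ e Qe → ℕ.≮⇒≥ λ e<b → none e e<b Qe)
  ... | inj₂ none  | no ¬Qb = inj₂ λ e e<1+b Qe → [ (λ e<b → none e e<b Qe)
                                                  , (λ { refl → ¬Qb Qe }) ]′ (ℕ.m≤n⇒m<n∨m≡n (ℕ.≤-pred e<1+b))

-- Binomial sums, dyadic scales and hit counts in the natural numbers.

module Arithmetic where
  open import Data.Nat.Base using (_+_; _*_; _^_; _≤_; _<_; z≤n; s≤s)

  binomialSum : ℕ → ℕ → ℕ
  binomialSum n zero    = 1
  binomialSum n (suc k) = n C suc k + binomialSum n k

  binomialSum-pascal : ∀ n k →
    binomialSum (suc n) (suc k) ≡ binomialSum n (suc k) + binomialSum n k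
  binomialSum-pascal n zero = begin
    suc n C 1 + 1       ≡⟨ cong (_+ 1) (nCk+nC[k+1]≡[n+1]C[k+1] n 0) ⟨
    (1 + n C 1) + 1     ≡⟨ cong (_+ 1) (ℕ.+-comm 1 (n C 1)) ⟩
    (n C 1 + 1) + 1     ∎
    where open ≡.≡-Reasoning
  binomialSum-pascal n (suc k) = begin
    suc n C suc (suc k) + binomialSum (suc n) (suc k)
      ≡⟨ cong₂ _+_ (≡.sym (nCk+nC[k+1]≡[n+1]C[k+1] n (suc k))) (binomialSum-pascal n k) ⟩
    (n C suc k + n C suc (suc k)) + ((n C suc k + binomialSum n k) + binomialSum n k)
      ≡⟨ rearrange (n C suc k) (n C suc (suc k)) (n C suc k + binomialSum n k) (binomialSum n k) ⟩
    (n C suc (suc k) + (n C suc k + binomialSum n k)) + (n C suc k + binomialSum n k) ∎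
    where
    open ≡.≡-Reasoning
    rearrange : ∀ a b c d → (a + b) + (c + d) ≡ (b + c) + (a + d)
    rearrange = solve-∀

  binomialSum-monoˡ : ∀ k {m n} → m ≤ n → binomialSum m k ≤ binomialSum n k
  binomialSum-monoˡ k m≤n = go (ℕ.≤⇒≤′ m≤n)
    where
    step : ∀ n k → binomialSum n k ≤ binomialSum (suc n) k
    step n zero    = ℕ.≤-refl
    step n (suc k) = ℕ.≤-trans (ℕ.m≤m+n _ _) (ℕ.≤-reflexive (≡.sym (binomialSum-pascal n k)))
    go : ∀ {m n} → m ℕ.≤′ n → binomialSum m k ≤ binomialSum n k
    go ℕ.≤′-refl        = ℕ.≤-refl
    go (ℕ.≤′-step m≤′n) = ℕ.≤-trans (go m≤′n) (step _ k)

  -- By Pascal's rule each of the `q` new elements raises the sum up to `suc k` by a sum up to `k`,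
  -- hence by at least `binomialSum m k`; the starting value supplies one more copy.
  binomialSum-step : ∀ q m k → suc q * binomialSum m k ≤ binomialSum (q + m) (suc k)
  binomialSum-step zero m k = ℕ.≤-trans (ℕ.≤-reflexive (ℕ.*-identityˡ _)) (ℕ.m≤n+m _ _)
  binomialSum-step (suc q) m k = begin
    binomialSum m k + suc q * binomialSum m k
      ≤⟨ ℕ.+-mono-≤ (binomialSum-monoˡ k (ℕ.m≤n+m m q)) (binomialSum-step q m k) ⟩
    binomialSum (q + m) k + binomialSum (q + m) (suc k) ≡⟨ ℕ.+-comm (binomialSum (q + m) k) _ ⟩
    binomialSum (q + m) (suc k) + binomialSum (q + m) k ≡⟨ binomialSum-pascal (q + m) k ⟨
    binomialSum (suc q + m) (suc k)                     ∎
    where open ℕ.≤-Reasoning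

  -- Among `k` disjoint blocks of `q` elements, choosing at most one element from each gives
  -- `suc q ^ k` subsets of size at most `k`. Each use of `binomialSum-step` adds one block.
  [1+q]^k≤binomialSum : ∀ q k {n} → k * q ≤ n → suc q ^ k ≤ binomialSum n k
  [1+q]^k≤binomialSum q k kq≤n = ℕ.≤-trans (go k) (binomialSum-monoˡ k kq≤n)
    where
    go : ∀ k → suc q ^ k ≤ binomialSum (k * q) k
    go zero    = ℕ.≤-refl
    go (suc k) = ℕ.≤-trans (ℕ.*-monoʳ-≤ (suc q) (go k)) (binomialSum-step q (k * q) k)

  -- Induction on `w`: the scale moves up exactly when `w` reaches the upper end `k * 2 ^ suc i`. It
  -- serves twice, to find the scale of a weight and, with `w` the dimension, to count the scales
  -- required.
  dyadicScale : ∀ k w → 1 ≤ k → k ≤ w → ∃ λ i → k * 2 ^ i ≤ w × w < k * 2 ^ suc i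
  dyadicScale k zero    1≤k k≤0 = contradiction (ℕ.≤-trans 1≤k k≤0) λ ()
  dyadicScale k (suc w) 1≤k k≤1+w with ℕ.m≤n⇒m<n∨m≡n k≤1+w
  ... | inj₂ refl = 0 , ℕ.≤-reflexive (ℕ.*-identityʳ k) , ℕ.m<m*n k 2 {{ℕ.>-nonZero 1≤k}} ℕ.≤-refl
  ... | inj₁ (s≤s k≤w) with dyadicScale k w 1≤k k≤w
  ...   | i , lo , hi with ℕ.m≤n⇒m<n∨m≡n hi
  ...     | inj₁ hi′ = i , ℕ.m≤n⇒m≤1+n lo , hi′
  ...     | inj₂ eq  = suc i , ℕ.≤-reflexive (≡.sym eq) , (begin-strict
              suc w                 ≡⟨ eq ⟩
              k * 2 ^ suc i         <⟨ ℕ.m<m*n (k * 2 ^ suc i) 2 {{ℕ.>-nonZero (subst (0 <_) eq (s≤s z≤n))}} ℕ.≤-refl ⟩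
              k * 2 ^ suc i * 2     ≡⟨ ℕ.*-assoc k (2 ^ suc i) 2 ⟩
              k * (2 ^ suc i * 2)   ≡⟨ cong (k *_) (ℕ.*-comm (2 ^ suc i) 2) ⟩
              k * 2 ^ suc (suc i)   ∎)
    where open ℕ.≤-Reasoning

  m≤2^m : ∀ m → m ≤ 2 ^ m
  m≤2^m zero    = z≤n
  m≤2^m (suc m) = ℕ.+-mono-≤ (ℕ.m^n>0 2 m) (ℕ.≤-trans (m≤2^m m) (ℕ.m≤m+n _ _))

  -- The first two terms of the binomial expansion, that is, Bernoulli's inequality made homogeneous
  -- so that no division occurs.
  bernoulli : ∀ b g r → b ^ suc r + suc r * g * b ^ r ≤ (b + g) ^ suc r
  bernoulli b g zero = ℕ.≤-reflexive (lemma b g)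
    where
    lemma : ∀ b g → b * 1 + (g + 0) * 1 ≡ (b + g) * 1
    lemma = solve-∀
  bernoulli b g (suc r) = begin
    b * b ^ suc r + suc (suc r) * g * b ^ suc r
      -- The added term, quadratic in `g`, is what completes the product in the next line.
      ≤⟨ ℕ.m≤m+n _ _ ⟩
    (b * b ^ suc r + suc (suc r) * g * b ^ suc r) + suc r * g * g * b ^ r
      ≡⟨ expand b g (suc r) (b ^ r) ⟩
    (b + g) * (b ^ suc r + suc r * g * b ^ r)
      ≤⟨ ℕ.*-monoʳ-≤ (b + g) (bernoulli b g r) ⟩
    (b + g) ^ suc (suc r) ∎
    where
    open ℕ.≤-Reasoning
    expand : ∀ b g r x → (b * (b * x) + suc r * g * (b * x)) + r * g * g * x
                       ≡ (b + g) * (b * x + r * g * x)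
    expand = solve-∀

  -- Seven independent trials of success probability at least 1/8 halve the
  -- failure probability.
  2b^7≤t^7 : ∀ {b g} → b + g ≤ 8 * g → 2 * b ^ 7 ≤ (b + g) ^ 7
  2b^7≤t^7 {b} {g} b+g≤8g = begin
    2 * b ^ 7             ≡⟨ cong (b ^ 7 +_) (ℕ.+-identityʳ _) ⟩
    -- Failures outnumber successes at most seven to one, so exponent seven is where the linear term
    -- of `bernoulli` supplies a second `b ^ 7`.
    b ^ 7 + b ^ 7         ≤⟨ ℕ.+-monoʳ-≤ (b ^ 7) (ℕ.*-monoˡ-≤ (b ^ 6) b≤7g) ⟩
    b ^ 7 + 7 * g * b ^ 6 ≤⟨ bernoulli b g 6 ⟩
    (b + g) ^ 7           ∎
    where
    open ℕ.≤-Reasoning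
    b≤7g : b ≤ 7 * g
    b≤7g = ℕ.+-cancelʳ-≤ g b (7 * g) (ℕ.≤-trans b+g≤8g (ℕ.≤-reflexive (ℕ.+-comm g (7 * g))))

  -- With suc p outcomes per coordinate, the numbers of choices for which
  -- exactly zero, respectively one, of the coordinates marked in x is hit.
  zeroHits oneHits : ∀ {n} → ℕ → Vec Bool n → ℕ
  zeroHits p []          = 1
  zeroHits p (false ∷ x) = suc p * zeroHits p x
  zeroHits p (true  ∷ x) = p * zeroHits p x
  oneHits p []          = 0
  oneHits p (false ∷ x) = suc p * oneHits p x
  oneHits p (true  ∷ x) = zeroHits p x + p * oneHits p x

  weight : ∀ {n} → Vec Bool n → ℕ
  weight []          = 0
  weight (false ∷ x) = weight x
  weight (true  ∷ x) = suc (weight x)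

  weight≤n : ∀ {n} (x : Vec Bool n) → weight x ≤ n
  weight≤n []          = z≤n
  weight≤n (false ∷ x) = ℕ.m≤n⇒m≤1+n (weight≤n x)
  weight≤n (true  ∷ x) = s≤s (weight≤n x)

  -- Replacing the single hit by any of the `p` missing outcomes turns a one-hit choice with such an
  -- outcome into a no-hit choice with one of the `weight x` marked coordinates singled out. This is
  -- the ratio w/p of the two probabilities.
  p*oneHits : ∀ {n} p (x : Vec Bool n) → p * oneHits p x ≡ weight x * zeroHits p x
  p*oneHits p []          = ℕ.*-zeroʳ p
  p*oneHits p (false ∷ x) = begin
    p * (suc p * oneHits p x)           ≡⟨ swap p (suc p) (oneHits p x) ⟩
    suc p * (p * oneHits p x)           ≡⟨ cong (suc p *_) (p*oneHits p x) ⟩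
    suc p * (weight x * zeroHits p x)   ≡⟨ swap (suc p) (weight x) (zeroHits p x) ⟩
    weight x * (suc p * zeroHits p x)   ∎
    where
    open ≡.≡-Reasoning
    swap : ∀ a b c → a * (b * c) ≡ b * (a * c)
    swap = solve-∀
  p*oneHits p (true ∷ x) = begin
    p * (zeroHits p x + p * oneHits p x)          ≡⟨ cong (λ y → p * (zeroHits p x + y)) (p*oneHits p x) ⟩
    p * (zeroHits p x + weight x * zeroHits p x)  ≡⟨ lemma p (zeroHits p x) (weight x) ⟩
    suc (weight x) * (p * zeroHits p x)           ∎
    where
    open ≡.≡-Reasoning
    lemma : ∀ p z w → p * (z + w * z) ≡ suc w * (p * z)
    lemma = solve-∀

  -- The union bound Z ≥ (1 - w/m) mⁿ, free of subtraction.
  zeroHits-bound : ∀ {n} p (x : Vec Bool n) →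
    suc p * suc p ^ n ≤ suc p * zeroHits p x + weight x * suc p ^ n
  zeroHits-bound p [] = ℕ.m≤m+n _ _
  zeroHits-bound {suc n} p (false ∷ x) = begin
    suc p * (suc p * suc p ^ n)                                    ≤⟨ ℕ.*-monoʳ-≤ (suc p) (zeroHits-bound p x) ⟩
    suc p * (suc p * zeroHits p x + weight x * suc p ^ n)          ≡⟨ lemma (suc p) (zeroHits p x) (weight x) (suc p ^ n) ⟩
    suc p * (suc p * zeroHits p x) + weight x * (suc p * suc p ^ n) ∎
    where
    open ℕ.≤-Reasoning
    lemma : ∀ m z w t → m * (m * z + w * t) ≡ m * (m * z) + w * (m * t)
    lemma = solve-∀
  zeroHits-bound {suc n} p (true ∷ x) = begin
    suc p * (suc p * suc p ^ n)
      ≡⟨ lemma₁ p (suc p ^ n) ⟩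
    p * (suc p * suc p ^ n) + suc p * suc p ^ n
      ≤⟨ ℕ.+-monoˡ-≤ _ (ℕ.*-monoʳ-≤ p (zeroHits-bound p x)) ⟩
    p * (suc p * zeroHits p x + weight x * suc p ^ n) + suc p * suc p ^ n
      ≤⟨ ℕ.m≤m+n _ (weight x * suc p ^ n) ⟩
    p * (suc p * zeroHits p x + weight x * suc p ^ n) + suc p * suc p ^ n + weight x * suc p ^ n
      ≡⟨ lemma₂ p (zeroHits p x) (weight x) (suc p ^ n) ⟩
    suc p * (p * zeroHits p x) + suc (weight x) * (suc p * suc p ^ n) ∎
    where
    open ℕ.≤-Reasoning
    lemma₁ : ∀ p t → suc p * (suc p * t) ≡ p * (suc p * t) + suc p * t
    lemma₁ = solve-∀
    lemma₂ : ∀ p z w t → p * (suc p * z + w * t) + suc p * t + w * t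
                       ≡ suc p * (p * z) + suc w * (suc p * t)
    lemma₂ = solve-∀

  -- With m = `suc p`, the union bound and 2w ≤ m leave at least half of all choices without a hit.
  -- The ratio w/p exceeds 1/4 because p < m ≤ 4w, so at least an eighth of the choices have exactly
  -- one hit. The hypothesis `1 ≤ p` permits cancelling `p`.
  oneHits-bound : ∀ {n} p (x : Vec Bool n) → 1 ≤ p →
    2 * weight x ≤ suc p → suc p ≤ 4 * weight x → suc p ^ n ≤ 8 * oneHits p x
  oneHits-bound {n} p@(suc _) x _ 2w≤m m≤4w = begin
    suc p ^ n               ≤⟨ ℕ.*-cancelˡ-≤ (suc p) mt≤m2z ⟩
    2 * zeroHits p x        ≤⟨ ℕ.*-monoʳ-≤ 2 (ℕ.*-cancelˡ-≤ p pz≤p4g) ⟩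
    2 * (4 * oneHits p x)   ≡⟨ ℕ.*-assoc 2 4 (oneHits p x) ⟨
    8 * oneHits p x         ∎
    where
    open ℕ.≤-Reasoning
    t = suc p ^ n
    z = zeroHits p x
    w = weight x
    lemma₁ : ∀ m z w t → 2 * (m * z + w * t) ≡ m * (2 * z) + 2 * w * t
    lemma₁ = solve-∀
    lemma₂ : ∀ w z → 4 * w * z ≡ 4 * (w * z)
    lemma₂ = solve-∀
    lemma₃ : ∀ p g → 4 * (p * g) ≡ p * (4 * g)
    lemma₃ = solve-∀
    mt≤m2z : suc p * t ≤ suc p * (2 * z)
    mt≤m2z = ℕ.+-cancelʳ-≤ (suc p * t) _ _ (begin
      suc p * t + suc p * t             ≡⟨ cong (suc p * t +_) (ℕ.+-identityʳ _) ⟨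
      2 * (suc p * t)                   ≤⟨ ℕ.*-monoʳ-≤ 2 (zeroHits-bound p x) ⟩
      2 * (suc p * z + w * t)           ≡⟨ lemma₁ (suc p) z w t ⟩
      suc p * (2 * z) + 2 * w * t       ≤⟨ ℕ.+-monoʳ-≤ _ (ℕ.*-monoˡ-≤ t 2w≤m) ⟩
      suc p * (2 * z) + suc p * t       ∎)
    pz≤p4g : p * z ≤ p * (4 * oneHits p x)
    pz≤p4g = begin
      p * z                   ≤⟨ ℕ.*-monoˡ-≤ z (ℕ.≤-trans (ℕ.n≤1+n p) m≤4w) ⟩
      4 * w * z               ≡⟨ lemma₂ w z ⟩
      4 * (w * z)             ≡⟨ cong (4 *_) (p*oneHits p x) ⟨
      4 * (p * oneHits p x)   ≡⟨ lemma₃ p (oneHits p x) ⟩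
      p * (4 * oneHits p x)   ∎

-- Ordered-field facts, the Archimedean property and lower bounds for `log₂`.

module OrderedField (ℝ : Reals) where
  open Reals ℝ
  module R = CommutativeRing commutativeRing
  module ≤ = IsDecTotalOrder isDecTotalOrder
  open import Algebra.Properties.Ring R.ring public
    using (-0#≈0#; -‿distribʳ-*; x≈y⇒x∙y⁻¹≈ε; xyx⁻¹≈y)
  open import Algebra.Properties.Semiring.Mult semiring using (×1-homo-*; ×-homo-+)
  open import Algebra.Properties.Semiring.Exp semiring using (^-homo-*; ^-assocʳ)

  poset : Poset 0ℓ 0ℓ 0ℓ
  poset = record { isPartialOrder = ≤.isPartialOrder }

  open import Relation.Binary.Reasoning.PartialOrder poset

  +-monoʳ-≤ : ∀ {x y} z → x ≤ y → z + x ≤ z + y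
  +-monoʳ-≤ {x} {y} z x≤y = begin
    z + x ≈⟨ R.+-comm z x ⟩
    x + z ≤⟨ +-monoˡ-≤ z x≤y ⟩
    y + z ≈⟨ R.+-comm y z ⟩
    z + y ∎

  +-mono-≤ : ∀ {x y u v} → x ≤ y → u ≤ v → x + u ≤ y + v
  +-mono-≤ x≤y u≤v = ≤.trans (+-monoˡ-≤ _ x≤y) (+-monoʳ-≤ _ u≤v)

  +-cancelʳ-≈ : ∀ x z → (x + z) - z ≈ x
  +-cancelʳ-≈ x z = begin-equality
    (x + z) - z   ≈⟨ R.+-assoc x z (- z) ⟩
    x + (z - z)   ≈⟨ R.+-congˡ (R.-‿inverseʳ z) ⟩
    x + 0#        ≈⟨ R.+-identityʳ x ⟩
    x             ∎

  +-cancelʳ-≤ : ∀ {x y} z → x + z ≤ y + z → x ≤ y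
  +-cancelʳ-≤ {x} {y} z x+z≤y+z = begin
    x             ≈⟨ +-cancelʳ-≈ x z ⟨
    (x + z) - z   ≤⟨ +-monoˡ-≤ (- z) x+z≤y+z ⟩
    (y + z) - z   ≈⟨ +-cancelʳ-≈ y z ⟩
    y             ∎

  x≤y⇒0≤y-x : ∀ {x y} → x ≤ y → 0# ≤ y - x
  x≤y⇒0≤y-x {x} {y} x≤y = begin
    0#    ≈⟨ R.-‿inverseʳ x ⟨
    x - x ≤⟨ +-monoˡ-≤ (- x) x≤y ⟩
    y - x ∎

  *-monoˡ-≤ : ∀ {x y z} → 0# ≤ z → x ≤ y → z * x ≤ z * y
  *-monoˡ-≤ {x} {y} {z} 0≤z x≤y = begin
    z * x                     ≈⟨ R.+-identityˡ (z * x) ⟨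
    0# + z * x                ≤⟨ +-monoˡ-≤ (z * x) (*-nonNeg 0≤z (x≤y⇒0≤y-x x≤y)) ⟩
    z * (y - x) + z * x       ≈⟨ R.distribˡ z (y - x) x ⟨
    z * ((y - x) + x)         ≈⟨ R.*-congˡ (R.+-assoc y (- x) x) ⟩
    z * (y + (- x + x))       ≈⟨ R.*-congˡ (R.+-congˡ (R.-‿inverseˡ x)) ⟩
    z * (y + 0#)              ≈⟨ R.*-congˡ (R.+-identityʳ y) ⟩
    z * y                     ∎

  *-monoʳ-≤ : ∀ {x y z} → 0# ≤ z → x ≤ y → x * z ≤ y * z
  *-monoʳ-≤ {x} {y} {z} 0≤z x≤y = begin
    x * z ≈⟨ R.*-comm x z ⟩
    z * x ≤⟨ *-monoˡ-≤ 0≤z x≤y ⟩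
    z * y ≈⟨ R.*-comm z y ⟩
    y * z ∎

  0≤1 : 0# ≤ 1#
  0≤1 with ≤.total 0# 1#
  ... | inj₁ 0≤1 = 0≤1
  ... | inj₂ 1≤0 = begin
    0#              ≤⟨ *-nonNeg 0≤-1 0≤-1 ⟩
    - 1# * - 1#     ≈⟨ -‿distribʳ-* (- 1#) 1# ⟨
    - (- 1# * 1#)   ≈⟨ R.-‿cong (R.*-identityʳ (- 1#)) ⟩
    - - 1#          ≈⟨ R.+-identityˡ (- - 1#) ⟨
    0# - - 1#       ≈⟨ R.+-congʳ (R.-‿inverseʳ 1#) ⟨
    (1# - 1#) - - 1# ≈⟨ +-cancelʳ-≈ 1# (- 1#) ⟩
    1#              ∎
    where
    0≤-1 : 0# ≤ - 1#
    0≤-1 = ≤.trans (x≤y⇒0≤y-x 1≤0) (≤.reflexive (R.+-identityˡ (- 1#)))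

  1≰0 : ¬ 1# ≤ 0#
  1≰0 1≤0 = 0≉1 (≤.antisym 0≤1 1≤0)

  1+x≰x : ∀ x → ¬ 1# + x ≤ x
  1+x≰x x 1+x≤x = 1≰0 (+-cancelʳ-≤ x (≤.trans 1+x≤x (≤.reflexive (R.sym (R.+-identityˡ x)))))

  fromℕ-homo-+ : ∀ a b → fromℕ (a ℕ.+ b) ≈ fromℕ a + fromℕ b
  fromℕ-homo-+ = ×-homo-+ 1#

  fromℕ-homo-* : ∀ a b → fromℕ (a ℕ.* b) ≈ fromℕ a * fromℕ b
  fromℕ-homo-* = ×1-homo-*

  fromℕ-homo-^ : ∀ a k → fromℕ (a ℕ.^ k) ≈ fromℕ a ^ k
  fromℕ-homo-^ a zero    = R.+-identityʳ 1#
  fromℕ-homo-^ a (suc k) = R.trans (fromℕ-homo-* a (a ℕ.^ k)) (R.*-congˡ (fromℕ-homo-^ a k))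

  0≤fromℕ : ∀ a → 0# ≤ fromℕ a
  0≤fromℕ zero    = ≤.refl
  0≤fromℕ (suc a) = begin
    0#            ≈⟨ R.+-identityʳ 0# ⟨
    0# + 0#       ≤⟨ +-mono-≤ 0≤1 (0≤fromℕ a) ⟩
    1# + fromℕ a  ∎

  fromℕ-mono-≤ : ∀ {a b} → a ℕ.≤ b → fromℕ a ≤ fromℕ b
  fromℕ-mono-≤ {b = b} ℕ.z≤n = 0≤fromℕ b
  fromℕ-mono-≤ (ℕ.s≤s a≤b)   = +-monoʳ-≤ 1# (fromℕ-mono-≤ a≤b)

  fromℕ-cancel-≤ : ∀ {a b} → fromℕ a ≤ fromℕ b → a ℕ.≤ b
  fromℕ-cancel-≤ {a} {b} a≤b = ℕ.≮⇒≥ λ b<a → 1+x≰x (fromℕ b) (≤.trans (fromℕ-mono-≤ {suc b} b<a) a≤b)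

  0<fromℕ : ∀ a .{{_ : NonZero a}} → 0# < fromℕ a
  0<fromℕ (suc a) = 0≤fromℕ (suc a) , λ 0≈1+a → 1≰0 (begin
    1#            ≈⟨ R.+-identityʳ 1# ⟨
    1# + 0#       ≤⟨ +-monoʳ-≤ 1# (0≤fromℕ a) ⟩
    1# + fromℕ a  ≈⟨ 0≈1+a ⟨
    0#            ∎)

  ⁻¹-inverse : ∀ {x} → 0# < x → x * x ⁻¹ ≈ 1#
  ⁻¹-inverse (_ , 0≉x) = ⁻¹-inverseʳ (0≉x ∘ R.sym)

  *-cancelˡ-≤ : ∀ {x y z} → 0# < z → z * x ≤ z * y → x ≤ y
  *-cancelˡ-≤ {x} {y} {z} 0<z zx≤zy with ≤.total x y
  ... | inj₁ x≤y = x≤y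
  ... | inj₂ y≤x = ≤.reflexive (begin-equality
    x               ≈⟨ divide x ⟨
    z ⁻¹ * (z * x)  ≈⟨ R.*-congˡ (≤.antisym zx≤zy (*-monoˡ-≤ (proj₁ 0<z) y≤x)) ⟩
    z ⁻¹ * (z * y)  ≈⟨ divide y ⟩
    y               ∎)
    where
    divide : ∀ u → z ⁻¹ * (z * u) ≈ u
    divide u = begin-equality
      z ⁻¹ * (z * u)  ≈⟨ R.*-assoc (z ⁻¹) z u ⟨
      (z ⁻¹ * z) * u  ≈⟨ R.*-congʳ (R.trans (R.*-comm (z ⁻¹) z) (⁻¹-inverse 0<z)) ⟩
      1# * u          ≈⟨ R.*-identityˡ u ⟩
      u               ∎

  0≤⁻¹ : ∀ {x} → 0# < x → 0# ≤ x ⁻¹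
  0≤⁻¹ {x} 0<x = *-cancelˡ-≤ 0<x (begin
    x * 0#    ≈⟨ R.zeroʳ x ⟩
    0#        ≤⟨ 0≤1 ⟩
    1#        ≈⟨ ⁻¹-inverse 0<x ⟨
    x * x ⁻¹  ∎)

  ^-nonNeg : ∀ {x} n → 0# ≤ x → 0# ≤ x ^ n
  ^-nonNeg zero    0≤x = 0≤1
  ^-nonNeg (suc n) 0≤x = *-nonNeg 0≤x (^-nonNeg n 0≤x)

  ^-monoˡ-≤ : ∀ {x y} n → 0# ≤ x → x ≤ y → x ^ n ≤ y ^ n
  ^-monoˡ-≤ zero    0≤x x≤y = ≤.refl
  ^-monoˡ-≤ (suc n) 0≤x x≤y = ≤.trans (*-monoˡ-≤ 0≤x (^-monoˡ-≤ n 0≤x x≤y))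
    (*-monoʳ-≤ (^-nonNeg n (≤.trans 0≤x x≤y)) x≤y)

  -- If no natural number reached `x`, the naturals would have a supremum `s`; since n + 1 ≤ s for
  -- every n, `s - 1#` would be a smaller upper bound.
  archimedean : (∀ (P : Set) → Dec P) → ∀ x → ∃ λ n → x ≤ fromℕ n
  archimedean dec x with dec (∃ λ n → x ≤ fromℕ n)
  ... | yes bound    = bound
  ... | no  no-bound = contradiction (begin
    1# + (s - 1#)   ≈⟨ R.+-assoc 1# s (- 1#) ⟨
    (1# + s) - 1#   ≈⟨ xyx⁻¹≈y 1# s ⟩
    s               ≤⟨ proj₂ s-isLUB (λ {y} (n , y≈n) → begin
        y                       ≈⟨ y≈n ⟩
        fromℕ n                 ≈⟨ xyx⁻¹≈y 1# (fromℕ n) ⟨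
        (1# + fromℕ n) - 1#     ≤⟨ +-monoˡ-≤ (- 1#) (proj₁ s-isLUB (suc n , R.refl)) ⟩
        s - 1#                  ∎) ⟩
    s - 1#          ∎) (1+x≰x (s - 1#))
    where
    Naturals : Pred Carrier 0ℓ
    Naturals y = ∃ λ n → y ≈ fromℕ n
    s = sup Naturals
    s-isLUB : IsLUB Naturals s
    s-isLUB = sup-isLUB Naturals (0# , 0 , R.refl)
      (x , λ (n , y≈n) → ≤.trans (≤.reflexive y≈n)
        ([ id , (λ x≤n → contradiction (n , x≤n) no-bound) ]′ (≤.total (fromℕ n) x)))

  -- The cap `y ≤ fromℕ 2 ^ N` is there because `sup` is specified only on bounded sets: it makes
  -- `fromℕ N` an upper bound of the admissible exponents. Membership of `s` itself then gives the
  -- claim.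
  fromℕ≤log₂ : ∀ {y} s N → fromℕ 2 ^ s ≤ y → y ≤ fromℕ 2 ^ N → fromℕ s ≤ log₂ y
  fromℕ≤log₂ {y} s N 2^s≤y y≤2^N = proj₁ (sup-isLUB _ (fromℕ s , s∈) (fromℕ N , bounded)) s∈
    where
    s∈ : ∃ λ a → ∃ λ b → ∃ λ q → ℕ.NonZero q ×
         fromℕ q * fromℕ s ≈ fromℕ a - fromℕ b × fromℕ 2 ^ a ≤ fromℕ 2 ^ b * y ^ q
    -- The exponent `s` is written as the fraction (s - 0) / 1.
    s∈ = s , 0 , 1 , _ , (begin-equality
      fromℕ 1 * fromℕ s   ≈⟨ R.*-congʳ (R.+-identityʳ 1#) ⟩
      1# * fromℕ s        ≈⟨ R.*-identityˡ (fromℕ s) ⟩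
      fromℕ s             ≈⟨ R.+-identityʳ (fromℕ s) ⟨
      fromℕ s + 0#        ≈⟨ R.+-congˡ -0#≈0# ⟨
      fromℕ s - 0#        ∎) , (begin
      fromℕ 2 ^ s         ≤⟨ 2^s≤y ⟩
      y                   ≈⟨ R.*-identityʳ y ⟨
      y * 1#              ≈⟨ R.*-identityˡ (y * 1#) ⟨
      1# * (y * 1#)       ∎)

    bounded : ∀ {r} → (∃ λ a → ∃ λ b → ∃ λ q → ℕ.NonZero q ×
      fromℕ q * r ≈ fromℕ a - fromℕ b × fromℕ 2 ^ a ≤ fromℕ 2 ^ b * y ^ q) → r ≤ fromℕ N
    bounded {r} (a , b , q , q≢0 , qr≈a-b , 2^a≤2^b*y^q) = *-cancelˡ-≤ (0<fromℕ q {{q≢0}}) (begin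
      fromℕ q * r                             ≈⟨ qr≈a-b ⟩
      fromℕ a - fromℕ b                       ≤⟨ +-monoˡ-≤ (- fromℕ b) (fromℕ-mono-≤ a≤b+Nq) ⟩
      fromℕ (b ℕ.+ N ℕ.* q) - fromℕ b         ≈⟨ R.+-congʳ (fromℕ-homo-+ b (N ℕ.* q)) ⟩
      (fromℕ b + fromℕ (N ℕ.* q)) - fromℕ b   ≈⟨ xyx⁻¹≈y (fromℕ b) (fromℕ (N ℕ.* q)) ⟩
      fromℕ (N ℕ.* q)                         ≈⟨ fromℕ-homo-* N q ⟩
      fromℕ N * fromℕ q                       ≈⟨ R.*-comm (fromℕ N) (fromℕ q) ⟩
      fromℕ q * fromℕ N                       ∎)
      where
      0≤y : 0# ≤ y
      0≤y = ≤.trans (^-nonNeg s (0≤fromℕ 2)) 2^s≤y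
      a≤b+Nq : a ℕ.≤ b ℕ.+ N ℕ.* q
      a≤b+Nq = 2^-cancel-≤ (fromℕ-cancel-≤ (begin
        fromℕ (2 ℕ.^ a)                   ≈⟨ fromℕ-homo-^ 2 a ⟩
        fromℕ 2 ^ a                       ≤⟨ 2^a≤2^b*y^q ⟩
        fromℕ 2 ^ b * y ^ q               ≤⟨ *-monoˡ-≤ (^-nonNeg b (0≤fromℕ 2)) (^-monoˡ-≤ q 0≤y y≤2^N) ⟩
        fromℕ 2 ^ b * (fromℕ 2 ^ N) ^ q   ≈⟨ R.*-congˡ (^-assocʳ (fromℕ 2) N q) ⟩
        fromℕ 2 ^ b * fromℕ 2 ^ (N ℕ.* q) ≈⟨ ^-homo-* (fromℕ 2) b (N ℕ.* q) ⟨
        fromℕ 2 ^ (b ℕ.+ N ℕ.* q)         ≈⟨ fromℕ-homo-^ 2 (b ℕ.+ N ℕ.* q) ⟨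
        fromℕ (2 ℕ.^ (b ℕ.+ N ℕ.* q))     ∎))
        where
        2^-cancel-≤ : ∀ {m n} → 2 ℕ.^ m ℕ.≤ 2 ℕ.^ n → m ℕ.≤ n
        2^-cancel-≤ 2^m≤2^n = ℕ.≮⇒≥ λ n<m →
          ℕ.<⇒≱ (ℕ.^-monoʳ-< 2 (ℕ.s≤s (ℕ.s≤s ℕ.z≤n)) n<m) 2^m≤2^n

-- Counting in lists, independent draws and disjoint unions.

module Counting (dec : (P : Set) → Dec P) where
  open import Algebra.Properties.CommutativeSemigroup ℕ.+-commutativeSemigroup using (interchange)
  open import Algebra.Properties.CommutativeSemigroup ℕ.*-commutativeSemigroup
    using () renaming (interchange to *-interchange)
  open import Data.Nat.Base using (_+_; _*_; _^_; _≤_; _<_; z≤n; s≤s)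

  indicator : Set → ℕ
  indicator P = if does (dec P) then 1 else 0

  indicator-mono : ∀ {P Q : Set} → (P → Q) → indicator P ≤ indicator Q
  indicator-mono {P} {Q} P→Q with dec P | dec Q
  ... | yes p | yes _ = ℕ.≤-refl
  ... | yes p | no ¬q = contradiction (P→Q p) ¬q
  ... | no _  | _     = z≤n

  1≤indicator : ∀ {P : Set} → P → 1 ≤ indicator P
  1≤indicator {P} p with dec P
  ... | yes _ = ℕ.≤-refl
  ... | no ¬p = contradiction p ¬p

  indicator≤0 : ∀ {P : Set} → ¬ P → indicator P ≤ 0
  indicator≤0 {P} ¬p with dec P
  ... | yes p = contradiction p ¬p
  ... | no _  = z≤n

  indicator-∁ : ∀ (P : Set) → indicator (¬ P) + indicator P ≡ 1
  indicator-∁ P with dec P | dec (¬ P)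
  ... | yes p | yes ¬p = contradiction p ¬p
  ... | yes p | no _   = refl
  ... | no _  | yes _  = refl
  ... | no ¬p | no ¬¬p = contradiction ¬p ¬¬p

  indicator-∪ : ∀ {P Q : Set} → ¬ (P × Q) → indicator P + indicator Q ≤ indicator (P ⊎ Q)
  indicator-∪ {P} {Q} ¬pq with dec P
  ... | yes p = ℕ.≤-trans (s≤s (indicator≤0 λ q → ¬pq (p , q))) (1≤indicator (inj₁ p))
  ... | no _  = indicator-mono inj₂

  -- Counted with multiplicity, so that repeating an entry of a list gives it more weight under a
  -- uniform draw.
  count : ∀ {A : Set} → Pred A 0ℓ → List A → ℕ
  count P []       = 0
  count P (x ∷ xs) = indicator (P x) + count P xs

  module _ {A : Set} where

    count-mono : ∀ {P Q : Pred A 0ℓ} → P ⊆ Q → ∀ xs → count P xs ≤ count Q xs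
    count-mono P⊆Q []       = z≤n
    count-mono P⊆Q (x ∷ xs) = ℕ.+-mono-≤ (indicator-mono P⊆Q) (count-mono P⊆Q xs)

    count-none : ∀ {P : Pred A 0ℓ} {xs} → All (∁ P) xs → count P xs ≤ 0
    count-none []         = z≤n
    count-none (¬p ∷ ¬ps) = ℕ.+-mono-≤ (indicator≤0 ¬p) (count-none ¬ps)

    count-∁ : ∀ (P : Pred A 0ℓ) xs → count (∁ P) xs + count P xs ≡ List.length xs
    count-∁ P []       = refl
    count-∁ P (x ∷ xs) = begin
      (indicator (¬ P x) + count (∁ P) xs) + (indicator (P x) + count P xs)
        ≡⟨ interchange (indicator (¬ P x)) _ _ _ ⟩
      (indicator (¬ P x) + indicator (P x)) + (count (∁ P) xs + count P xs)
        ≡⟨ cong₂ _+_ (indicator-∁ (P x)) (count-∁ P xs) ⟩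
      suc (List.length xs) ∎
      where open ≡.≡-Reasoning

    count-all : ∀ {P : Pred A 0ℓ} {xs} → All P xs → count P xs ≡ List.length xs
    count-all {P} {xs} ps = ≡.trans
      (cong (_+ count P xs) (≡.sym (ℕ.n≤0⇒n≡0 (count-none {∁ P} (All.map (λ p ¬p → ¬p p) ps)))))
      (count-∁ P xs)

    count≤length : ∀ (P : Pred A 0ℓ) xs → count P xs ≤ List.length xs
    count≤length P xs = subst (count P xs ≤_) (count-∁ P xs) (ℕ.m≤n+m _ _)

    count-++ : ∀ (P : Pred A 0ℓ) xs ys → count P (xs ++ ys) ≡ count P xs + count P ys
    count-++ P []       ys = refl
    count-++ P (x ∷ xs) ys = ≡.trans (cong (indicator (P x) +_) (count-++ P xs ys))
      (≡.sym (ℕ.+-assoc (indicator (P x)) _ _))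

    count-map : ∀ {B : Set} (P : Pred A 0ℓ) (f : B → A) xs → count P (List.map f xs) ≡ count (P ∘ f) xs
    count-map P f []       = refl
    count-map P f (x ∷ xs) = cong (indicator (P (f x)) +_) (count-map P f xs)

    count-∪ : ∀ {P Q : Pred A 0ℓ} → Empty (P ∩ Q) → ∀ xs →
              count P xs + count Q xs ≤ count (P ∪ Q) xs
    count-∪ disjoint []       = z≤n
    count-∪ {P} {Q} disjoint (x ∷ xs) = ℕ.≤-trans
      (ℕ.≤-reflexive (interchange (indicator (P x)) _ _ _))
      (ℕ.+-mono-≤ (indicator-∪ (disjoint x)) (count-∪ disjoint xs))

  count-cartesianProductWith : ∀ {A B D : Set} {P : Pred A 0ℓ} {Q : Pred B 0ℓ} {R : Pred D 0ℓ}
    {f : A → B → D} → (∀ {x y} → R (f x y) → P x × Q y) → ∀ xs ys →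
    count R (List.cartesianProductWith f xs ys) ≤ count P xs * count Q ys
  count-cartesianProductWith R⇒P×Q [] ys = z≤n
  count-cartesianProductWith {P = P} {Q} {R} {f} R⇒P×Q (x ∷ xs) ys = begin
    count R (List.map (f x) ys ++ List.cartesianProductWith f xs ys)
      ≡⟨ count-++ R (List.map (f x) ys) _ ⟩
    count R (List.map (f x) ys) + count R (List.cartesianProductWith f xs ys)
      ≤⟨ ℕ.+-mono-≤ row (count-cartesianProductWith R⇒P×Q xs ys) ⟩
    indicator (P x) * count Q ys + count P xs * count Q ys
      ≡⟨ ℕ.*-distribʳ-+ (count Q ys) (indicator (P x)) (count P xs) ⟨
    (indicator (P x) + count P xs) * count Q ys ∎
    where
    open ℕ.≤-Reasoning
    row : count R (List.map (f x) ys) ≤ indicator (P x) * count Q ys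
    row = subst (_≤ indicator (P x) * count Q ys) (≡.sym (count-map R (f x) ys)) row′
      where
      row′ : count (R ∘ f x) ys ≤ indicator (P x) * count Q ys
      row′ with dec (P x)
      ... | yes _ = ℕ.≤-trans (count-mono (proj₂ ∘ R⇒P×Q) ys) (ℕ.≤-reflexive (≡.sym (ℕ.+-identityʳ _)))
      ... | no ¬p = count-none (All.universal (λ _ r → ¬p (proj₁ (R⇒P×Q r))) ys)

  length-cartesianProductWith : ∀ {A B D : Set} (f : A → B → D) xs ys →
    List.length (List.cartesianProductWith f xs ys) ≡ List.length xs * List.length ys
  length-cartesianProductWith f []       ys = refl
  length-cartesianProductWith f (x ∷ xs) ys = ≡.trans (List.length-++ (List.map (f x) ys))
    (cong₂ _+_ (List.length-map (f x) ys) (length-cartesianProductWith f xs ys))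

  -- The sample space of independent draws, one per list. The length in the type becomes the number
  -- of linear forms in a covering polynomial.
  tuples : ∀ {A : Set} (Xs : List (List A)) → List (Vec A (List.length Xs))
  tuples []       = [] ∷ []
  tuples (X ∷ Xs) = List.cartesianProductWith _∷_ X (tuples Xs)

  length-tuples : ∀ {A : Set} (Xs : List (List A)) →
    List.length (tuples Xs) ≡ product (List.map List.length Xs)
  length-tuples []       = refl
  length-tuples (X ∷ Xs) = ≡.trans (length-cartesianProductWith _∷_ X (tuples Xs))
    (cong (List.length X *_) (length-tuples Xs))

  count-tuples : ∀ {A : Set} (P : Pred A 0ℓ) (Xs : List (List A)) →
    count (VecAll.All P) (tuples Xs) ≤ product (List.map (count P) Xs)
  count-tuples P []       = count≤length (VecAll.All P) ([] ∷ [])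
  count-tuples P (X ∷ Xs) = ℕ.≤-trans
    (count-cartesianProductWith {P = P} {VecAll.All P} (λ { (p VecAll.∷ ps) → p , ps }) X (tuples Xs))
    (ℕ.*-monoʳ-≤ (count P X) (count-tuples P Xs))

  -- Independent uniform draws, one from each list of Xs, all satisfy P with
  -- probability at most 1/c.
  AvoidsUpTo : ∀ {A : Set} → ℕ → Pred A 0ℓ → Pred (List (List A)) 0ℓ
  AvoidsUpTo c P Xs = c * product (List.map (count P) Xs) ≤ product (List.map List.length Xs)

  module _ {A : Set} {P : Pred A 0ℓ} where

    avoids-++ : ∀ {c d} Xs {Ys} → AvoidsUpTo c P Xs → AvoidsUpTo d P Ys → AvoidsUpTo (c * d) P (Xs ++ Ys)
    avoids-++ {c} {d} Xs {Ys} cXs dYs = begin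
      c * d * product (List.map (count P) (Xs ++ Ys))
        ≡⟨ cong (c * d *_) (product-map-++ (count P)) ⟩
      c * d * (product (List.map (count P) Xs) * product (List.map (count P) Ys))
        ≡⟨ *-interchange c d _ _ ⟩
      (c * product (List.map (count P) Xs)) * (d * product (List.map (count P) Ys))
        ≤⟨ ℕ.*-mono-≤ cXs dYs ⟩
      product (List.map List.length Xs) * product (List.map List.length Ys)
        ≡⟨ product-map-++ List.length ⟨
      product (List.map List.length (Xs ++ Ys)) ∎
      where
      open ℕ.≤-Reasoning
      product-map-++ : ∀ f → product (List.map f (Xs ++ Ys)) ≡ product (List.map f Xs) * product (List.map f Ys)
      product-map-++ f = ≡.trans (cong product (List.map-++ f Xs Ys)) (ℕ-List.product-++ (List.map f Xs) _)

    -- Used for padding: trials aimed at other weights cannot raise the probability that all trials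
    -- miss.
    avoids-1 : ∀ Xs → AvoidsUpTo 1 P Xs
    avoids-1 []       = ℕ.≤-refl
    avoids-1 (X ∷ Xs) = begin
      1 * (count P X * product (List.map (count P) Xs))  ≡⟨ swap (count P X) _ ⟩
      count P X * (1 * product (List.map (count P) Xs))  ≤⟨ ℕ.*-mono-≤ (count≤length P X) (avoids-1 Xs) ⟩
      List.length X * product (List.map List.length Xs)  ∎
      where
      open ℕ.≤-Reasoning
      swap : ∀ a b → 1 * (a * b) ≡ a * (1 * b)
      swap = solve-∀

    avoids-surely : ∀ c {X} → count P X ≤ 0 → AvoidsUpTo c P (X ∷ [])
    avoids-surely c {X} none = begin
      c * (count P X * 1) ≤⟨ ℕ.*-monoʳ-≤ c (ℕ.*-monoˡ-≤ 1 none) ⟩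
      c * 0               ≡⟨ ℕ.*-zeroʳ c ⟩
      0                   ≤⟨ z≤n ⟩
      List.length X * 1   ∎
      where open ℕ.≤-Reasoning

    -- Here `P` is failure, and a draw succeeds with probability at least 1/8. Each block of seven
    -- draws contributes one factor 2, and there are `K` blocks.
    avoids-replicate : ∀ {X} → List.length X ≤ 8 * count (∁ P) X → ∀ K →
      AvoidsUpTo (2 ^ K) P (List.replicate (K * 7) X)
    avoids-replicate {X} often zero    = ℕ.≤-refl
    avoids-replicate {X} often (suc K) =
      avoids-++ {2} {2 ^ K} (List.replicate 7 X) {List.replicate (K * 7) X} seven (avoids-replicate {X} often K)
      where
      b = count P X
      g = count (∁ P) X
      b+g≡t : b + g ≡ List.length X
      b+g≡t = ≡.trans (ℕ.+-comm b g) (count-∁ P X)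
      seven : 2 * b ^ 7 ≤ List.length X ^ 7
      seven = subst (λ t → 2 * b ^ 7 ≤ t ^ 7) b+g≡t
        (Arithmetic.2b^7≤t^7 {b} {g} (subst (_≤ 8 * g) (≡.sym b+g≡t) often))

    -- Block `i` alone supplies the factor `c`; every other block is padding.
    avoids-concat : ∀ c (F : ℕ → List (List A)) {i m} → i < m → AvoidsUpTo c P (F i) →
      AvoidsUpTo c P (List.concat (List.applyUpTo F m))
    avoids-concat c F {zero} {suc m} _ av =
      subst (λ d → AvoidsUpTo d P (F 0 ++ _)) (ℕ.*-identityʳ c)
        (avoids-++ {c} {1} (F 0) av (avoids-1 (List.concat (List.applyUpTo (F ∘ suc) m))))
    avoids-concat c F {suc i} {suc m} (s≤s i<m) av =
      subst (λ d → AvoidsUpTo d P (F 0 ++ _)) (ℕ.*-identityˡ c)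
        (avoids-++ {1} {c} (F 0) (avoids-1 (F 0)) (avoids-concat c (F ∘ suc) i<m av))

  length-concat-applyUpTo : ∀ {A : Set} (F : ℕ → List A) {l} → (∀ i → List.length (F i) ≡ l) → ∀ m →
    List.length (List.concat (List.applyUpTo F m)) ≡ m * l
  length-concat-applyUpTo F len zero    = refl
  length-concat-applyUpTo F len (suc m) = ≡.trans (List.length-++ (F 0))
    (cong₂ _+_ (len 0) (length-concat-applyUpTo (F ∘ suc) (len ∘ suc) m))

  prefixSum : (ℕ → ℕ) → ℕ → ℕ
  prefixSum g m = ℕ-List.sum (List.applyUpTo g m)

  prefixSum-+ : ∀ f g m → prefixSum (λ k → f k + g k) m ≡ prefixSum f m + prefixSum g m
  prefixSum-+ f g zero    = refl
  prefixSum-+ f g (suc m) = ≡.trans (cong (f 0 + g 0 +_) (prefixSum-+ (f ∘ suc) (g ∘ suc) m))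
    (interchange (f 0) _ _ _)

  prefixSum-mono : ∀ g {m n} → m ≤ n → prefixSum g m ≤ prefixSum g n
  prefixSum-mono g z≤n       = z≤n
  prefixSum-mono g (s≤s m≤n) = ℕ.+-monoʳ-≤ (g 0) (prefixSum-mono (g ∘ suc) m≤n)

  term≤prefixSum : ∀ g k → g k ≤ prefixSum g (suc k)
  term≤prefixSum g zero    = ℕ.m≤m+n _ _
  term≤prefixSum g (suc k) = ℕ.≤-trans (term≤prefixSum (g ∘ suc) k) (ℕ.m≤n+m _ (g 0))

  module _ {A : Set} where

    prefixSum≤count-⋃ : ∀ (P : ℕ → Pred A 0ℓ) → (∀ {j k} → j ≢ k → Empty (P j ∩ P k)) → ∀ xs m →
      prefixSum (λ k → count (P k) xs) m ≤ count (⋃ ℕ P) xs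
    prefixSum≤count-⋃ P disjoint xs zero    = z≤n
    prefixSum≤count-⋃ P disjoint xs (suc m) = begin
      count (P 0) xs + prefixSum (λ k → count (P (suc k)) xs) m
        ≤⟨ ℕ.+-monoʳ-≤ _ (prefixSum≤count-⋃ (P ∘ suc) (λ j≢k → disjoint (j≢k ∘ ℕ.suc-injective)) xs m) ⟩
      count (P 0) xs + count (⋃ ℕ (P ∘ suc)) xs
        ≤⟨ count-∪ (λ { x (p₀ , k , pₖ) → disjoint (λ ()) x (p₀ , pₖ) }) xs ⟩
      count (P 0 ∪ ⋃ ℕ (P ∘ suc)) xs
        ≤⟨ count-mono (λ { (inj₁ p₀) → 0 , p₀ ; (inj₂ (k , pₖ)) → suc k , pₖ }) xs ⟩
      count (⋃ ℕ P) xs ∎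
      where open ℕ.≤-Reasoning

    -- Each member of the list that lies in the union lies in some event of finite index. A prefix
    -- beyond these finitely many indices already accounts for the whole count, so countable
    -- additivity requires no limit.
    count-⋃≤prefixSum : ∀ (P : ℕ → Pred A 0ℓ) xs →
      ∃ λ m → count (⋃ ℕ P) xs ≤ prefixSum (λ k → count (P k) xs) m
    count-⋃≤prefixSum P [] = 0 , z≤n
    count-⋃≤prefixSum P (x ∷ xs) with count-⋃≤prefixSum P xs
    ... | m , bound = extend (dec (⋃ ℕ P x))
      where
      open ℕ.≤-Reasoning
      f g : ℕ → ℕ
      f k = indicator (P k x)
      g k = count (P k) xs
      extend : Dec (⋃ ℕ P x) → ∃ λ m → count (⋃ ℕ P) (x ∷ xs) ≤ prefixSum (λ k → f k + g k) m
      extend (yes (k , pₖ)) = suc k ℕ.⊔ m , (begin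
        indicator (⋃ ℕ P x) + count (⋃ ℕ P) xs
          ≤⟨ ℕ.+-mono-≤ (ℕ.≤-trans (indicator-mono (λ _ → pₖ)) (term≤prefixSum f k)) bound ⟩
        prefixSum f (suc k) + prefixSum g m
          ≤⟨ ℕ.+-mono-≤ (prefixSum-mono f (ℕ.m≤m⊔n (suc k) m)) (prefixSum-mono g (ℕ.m≤n⊔m (suc k) m)) ⟩
        prefixSum f (suc k ℕ.⊔ m) + prefixSum g (suc k ℕ.⊔ m)
          ≡⟨ prefixSum-+ f g (suc k ℕ.⊔ m) ⟨
        prefixSum (λ k → f k + g k) (suc k ℕ.⊔ m) ∎)
      extend (no ¬p) = m , (begin
        indicator (⋃ ℕ P x) + count (⋃ ℕ P) xs  ≤⟨ ℕ.+-mono-≤ (indicator≤0 ¬p) bound ⟩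
        prefixSum g m                           ≤⟨ ℕ.m≤n+m _ _ ⟩
        prefixSum f m + prefixSum g m           ≡⟨ prefixSum-+ f g m ⟨
        prefixSum (λ k → f k + g k) m           ∎)

-- The uniform distribution on a finite list as a probability measure.

module UniformMeasure (dec : (P : Set) → Dec P) (ℝ : Reals) where
  open Reals ℝ
  open Over ℝ
  open OrderedField ℝ
  open Counting dec
  open import Relation.Binary.Reasoning.PartialOrder poset

  frequency : ∀ {Ω : Set} → List Ω → Pred Ω 0ℓ → Carrier
  frequency xs A = fromℕ (count A xs) * fromℕ (List.length xs) ⁻¹

  frequency≤ : ∀ {Ω : Set} {xs : List Ω} .{{_ : NonZero (List.length xs)}} {A ε} →
    fromℕ (count A xs) ≤ ε * fromℕ (List.length xs) → frequency xs A ≤ ε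
  frequency≤ {xs = xs} {A} {ε} count≤ε*N = begin
    fromℕ (count A xs) * N ⁻¹ ≤⟨ *-monoʳ-≤ (0≤⁻¹ 0<N) count≤ε*N ⟩
    (ε * N) * N ⁻¹            ≈⟨ R.*-assoc ε N (N ⁻¹) ⟩
    ε * (N * N ⁻¹)            ≈⟨ R.*-congˡ (⁻¹-inverse 0<N) ⟩
    ε * 1#                    ≈⟨ R.*-identityʳ ε ⟩
    ε                         ∎
    where
    N = fromℕ (List.length xs)
    0<N : 0# < N
    0<N = 0<fromℕ (List.length xs)

  sum-frequency : ∀ (g : ℕ → ℕ) c m →
    sum (λ (k : Fin m) → fromℕ (g (toℕ k)) * c) ≈ fromℕ (prefixSum g m) * c
  sum-frequency g c zero    = R.sym (R.zeroˡ c)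
  sum-frequency g c (suc m) = begin-equality
    fromℕ (g 0) * c + sum (λ (k : Fin m) → fromℕ (g (suc (toℕ k))) * c)
      ≈⟨ R.+-congˡ (sum-frequency (g ∘ suc) c m) ⟩
    fromℕ (g 0) * c + fromℕ (prefixSum (g ∘ suc) m) * c
      ≈⟨ R.distribʳ c _ _ ⟨
    (fromℕ (g 0) + fromℕ (prefixSum (g ∘ suc) m)) * c
      ≈⟨ R.*-congʳ (fromℕ-homo-+ (g 0) _) ⟨
    fromℕ (prefixSum g (suc m)) * c ∎

  -- Every predicate can be counted, so all of them are declared measurable and only additivity has
  -- content. The partial sums never exceed the frequency of the union, and one of them attains it.
  uniform : ∀ {Ω : Set} (xs : List Ω) .{{_ : NonZero (List.length xs)}} → ProbabilityMeasure Ω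
  uniform {Ω} xs = record
    { Measurable      = λ _ → ⊤
    ; measurable-resp = _
    ; measurable-U    = _
    ; measurable-∁    = _
    ; measurable-⋃    = _
    ; Pr              = frequency xs
    ; Pr-cong         = λ { _ (A⊆B , B⊆A) → ≤.antisym (freq-mono (count-mono A⊆B xs)) (freq-mono (count-mono B⊆A xs)) }
    ; Pr-nonNeg       = λ {A} _ → *-nonNeg (0≤fromℕ (count A xs)) 0≤N⁻¹
    ; Pr-U            = R.trans
        (R.*-congʳ (R.reflexive (cong fromℕ (count-all {P = U} (All.universal _ xs))))) (⁻¹-inverse 0<N)
    ; σ-additive      = λ {A} _ disjoint →
        (λ { (m , s≈) → ≤.trans (≤.reflexive (R.trans s≈ (sum-frequency (λ k → count (A k) xs) _ m)))
                                (freq-mono (prefixSum≤count-⋃ A disjoint xs m)) }) ,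
        (λ bound → let (m , total≤) = count-⋃≤prefixSum A xs in
          ≤.trans (freq-mono total≤)
            (≤.trans (≤.reflexive (R.sym (sum-frequency (λ k → count (A k) xs) _ m)))
                     (bound (m , R.refl))))
    }
    where
    0<N : 0# < fromℕ (List.length xs)
    0<N = 0<fromℕ (List.length xs)
    0≤N⁻¹ : 0# ≤ fromℕ (List.length xs) ⁻¹
    0≤N⁻¹ = 0≤⁻¹ 0<N
    freq-mono : ∀ {a b} → a ℕ.≤ b → fromℕ a * fromℕ (List.length xs) ⁻¹ ≤ fromℕ b * fromℕ (List.length xs) ⁻¹
    freq-mono a≤b = *-monoʳ-≤ 0≤N⁻¹ (fromℕ-mono-≤ a≤b)

-- Evaluation and degree of hyperplane covering polynomials.

module HyperplaneCovering (ℝ : Reals) where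
  open Reals ℝ
  open Over ℝ
  open OrderedField ℝ
  open import Algebra.Properties.CommutativeSemigroup R.*-commutativeSemigroup using (interchange)
  open import Algebra.Properties.CommutativeSemigroup ℕ.+-commutativeSemigroup
    using () renaming (interchange to +-interchange)
  open import Algebra.Properties.Monoid.Sum R.+-monoid using (sum-cong-≋)
  open import Algebra.Properties.Ring R.ring using (-‿distribˡ-*; -‿+-comm)
  open import Algebra.Properties.Semiring.Exp semiring using (^-homo-*)
  open import Relation.Binary.Reasoning.PartialOrder poset

  monomial : ∀ {n} → Vec Carrier n → Vec ℕ n → Carrier
  monomial y m = Vec.foldr′ _*_ 1# (Vec.zipWith _^_ y m)

  dot : ∀ {n} → Vec Carrier n → Vec Carrier n → Carrier
  dot a y = sum λ i → Vec.lookup a i * Vec.lookup y i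

  monomial-+ : ∀ {n} (y : Vec Carrier n) k l →
    monomial y (Vec.zipWith ℕ._+_ k l) ≈ monomial y k * monomial y l
  monomial-+ []      []      []      = R.sym (R.*-identityˡ 1#)
  monomial-+ (u ∷ y) (i ∷ k) (j ∷ l) = begin-equality
    u ^ (i ℕ.+ j) * monomial y (Vec.zipWith ℕ._+_ k l)      ≈⟨ R.*-cong (^-homo-* u i j) (monomial-+ y k l) ⟩
    (u ^ i * u ^ j) * (monomial y k * monomial y l)         ≈⟨ interchange (u ^ i) (u ^ j) (monomial y k) (monomial y l) ⟩
    (u ^ i * monomial y k) * (u ^ j * monomial y l)         ∎

  monomial-0 : ∀ {n} (y : Vec Carrier n) → monomial y (Vec.replicate n 0) ≈ 1#
  monomial-0 []      = R.refl
  monomial-0 (u ∷ y) = R.trans (R.*-identityˡ _) (monomial-0 y)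

  monomial-unit : ∀ {n} (y : Vec Carrier n) i →
    monomial y (Vec.replicate n 0 Vec.[ i ]≔ 1) ≈ Vec.lookup y i
  monomial-unit (u ∷ y) zero    = begin-equality
    (u * 1#) * monomial y (Vec.replicate _ 0) ≈⟨ R.*-cong (R.*-identityʳ u) (monomial-0 y) ⟩
    u * 1#                                    ≈⟨ R.*-identityʳ u ⟩
    u                                         ∎
  monomial-unit (u ∷ y) (suc i) = R.trans (R.*-identityˡ _) (monomial-unit y i)

  module _ {n : ℕ} (y : Vec Carrier n) where

    eval-++ : ∀ (P Q : Poly n) → eval (P ++ Q) y ≈ eval P y + eval Q y
    eval-++ []            Q = R.sym (R.+-identityˡ _)
    eval-++ ((a , m) ∷ P) Q = R.trans (R.+-congˡ (eval-++ P Q)) (R.sym (R.+-assoc _ _ _))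

    eval-neg : ∀ (Q : Poly n) → eval (List.map (map₁ λ a → - a) Q) y ≈ - eval Q y
    eval-neg []            = R.sym -0#≈0#
    eval-neg ((a , m) ∷ Q) = begin-equality
      - a * monomial y m + eval (List.map (map₁ λ a → - a) Q) y ≈⟨ R.+-cong (R.sym (-‿distribˡ-* a _)) (eval-neg Q) ⟩
      - (a * monomial y m) - eval Q y                           ≈⟨ -‿+-comm _ _ ⟩
      - (a * monomial y m + eval Q y)                           ∎

    eval-- : ∀ (P Q : Poly n) → eval (P -ₚ Q) y ≈ eval P y - eval Q y
    eval-- P Q = R.trans (eval-++ P _) (R.+-congˡ (eval-neg Q))

    -- Stated for any `f` with the values of multiplication by the term `(a , k)`, because the
    -- function inside `_*ₚ_` is an anonymous pattern-matching lambda and is identified only by its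
    -- values.
    eval-scale : ∀ {a k} {f : Carrier × Vec ℕ n → Carrier × Vec ℕ n} →
      (∀ b l → f (b , l) ≡ (a * b , Vec.zipWith ℕ._+_ k l)) →
      ∀ Q → eval (List.map f Q) y ≈ (a * monomial y k) * eval Q y
    eval-scale f≡ [] = R.sym (R.zeroʳ _)
    eval-scale {a} {k} {f} f≡ ((b , l) ∷ Q) rewrite f≡ b l = begin-equality
      (a * b) * monomial y (Vec.zipWith ℕ._+_ k l) + eval (List.map f Q) y
        ≈⟨ R.+-cong (R.*-congˡ (monomial-+ y k l)) (eval-scale f≡ Q) ⟩
      (a * b) * (monomial y k * monomial y l) + (a * monomial y k) * eval Q y
        ≈⟨ R.+-congʳ (interchange a b _ _) ⟩
      (a * monomial y k) * (b * monomial y l) + (a * monomial y k) * eval Q y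
        ≈⟨ R.distribˡ _ _ _ ⟨
      (a * monomial y k) * (b * monomial y l + eval Q y) ∎

    eval-* : ∀ (P Q : Poly n) → eval (P *ₚ Q) y ≈ eval P y * eval Q y
    eval-* = go λ _ _ _ _ → refl
      where
      go : ∀ {f} → (∀ a k b l → f (a , k) (b , l) ≡ (a * b , Vec.zipWith ℕ._+_ k l)) →
           ∀ P Q → eval (List.cartesianProductWith f P Q) y ≈ eval P y * eval Q y
      go f≡ []            Q = R.sym (R.zeroˡ _)
      go {f} f≡ ((a , k) ∷ P) Q = begin-equality
        eval (List.map (f (a , k)) Q ++ List.cartesianProductWith f P Q) y
          ≈⟨ eval-++ (List.map (f (a , k)) Q) _ ⟩
        eval (List.map (f (a , k)) Q) y + eval (List.cartesianProductWith f P Q) y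
          ≈⟨ R.+-cong (eval-scale (f≡ a k) Q) (go f≡ P Q) ⟩
        (a * monomial y k) * eval Q y + eval P y * eval Q y
          ≈⟨ R.distribʳ _ _ _ ⟨
        (a * monomial y k + eval P y) * eval Q y ∎

    eval-1 : eval 1ₚ y ≈ 1#
    eval-1 = begin-equality
      1# * monomial y (Vec.replicate n 0) + 0#  ≈⟨ R.+-identityʳ _ ⟩
      1# * monomial y (Vec.replicate n 0)       ≈⟨ R.*-identityˡ _ ⟩
      monomial y (Vec.replicate n 0)            ≈⟨ monomial-0 y ⟩
      1#                                        ∎

    eval-tabulate : ∀ {l} (t : Fin l → Carrier × Vec ℕ n) →
      eval (Vec.toList (Vec.tabulate t)) y ≈ sum λ i → proj₁ (t i) * monomial y (proj₂ (t i))
    eval-tabulate {zero}  t = R.refl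
    eval-tabulate {suc l} t = R.+-congˡ (eval-tabulate (t ∘ suc))

    eval-linearForm : ∀ a → eval (linearForm a) y ≈ dot a y
    eval-linearForm a = R.trans
      (eval-tabulate λ i → Vec.lookup a i , (Vec.replicate n 0 Vec.[ i ]≔ 1))
      (sum-cong-≋ λ i → R.*-congˡ (monomial-unit y i))

  module _ {n : ℕ} where

    factors : ∀ {t} → Vec (Vec Carrier n) t → Poly n
    factors as = Vec.foldr′ _*ₚ_ 1ₚ (Vec.map (λ a → 1ₚ -ₚ linearForm a) as)

    covering : ∀ {t} → Vec (Vec Carrier n) t → Poly n
    covering as = 1ₚ -ₚ factors as

    eval-factors-∷ : ∀ {t} a (as : Vec (Vec Carrier n) t) y →
      eval (factors (a ∷ as)) y ≈ (1# - dot a y) * eval (factors as) y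
    eval-factors-∷ a as y = begin-equality
      eval ((1ₚ -ₚ linearForm a) *ₚ factors as) y         ≈⟨ eval-* y (1ₚ -ₚ linearForm a) (factors as) ⟩
      eval (1ₚ -ₚ linearForm a) y * eval (factors as) y   ≈⟨ R.*-congʳ (eval-- y 1ₚ (linearForm a)) ⟩
      (eval 1ₚ y - eval (linearForm a) y) * eval (factors as) y
        ≈⟨ R.*-congʳ (R.+-cong (eval-1 y) (R.-‿cong (eval-linearForm y a))) ⟩
      (1# - dot a y) * eval (factors as) y                ∎

    eval-covering : ∀ {t} (as : Vec (Vec Carrier n) t) y → eval (covering as) y ≈ 1# - eval (factors as) y
    eval-covering as y = R.trans (eval-- y 1ₚ (factors as)) (R.+-congʳ (eval-1 y))

    -- Where all forms vanish every factor is 1, and so is the product. At the zero input this rules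
    -- out errors.
    covering-vanishes : ∀ {y} → (∀ a → dot a y ≈ 0#) → ∀ {t} (as : Vec (Vec Carrier n) t) → eval (covering as) y ≈ 0#
    covering-vanishes {y} dot≈0 as = R.trans (eval-covering as y) (x≈y⇒x∙y⁻¹≈ε (R.sym (factors≈1 as)))
      where
      factors≈1 : ∀ {t} (as : Vec (Vec Carrier n) t) → eval (factors as) y ≈ 1#
      factors≈1 []       = eval-1 y
      factors≈1 (a ∷ as) = begin-equality
        eval (factors (a ∷ as)) y             ≈⟨ eval-factors-∷ a as y ⟩
        (1# - dot a y) * eval (factors as) y  ≈⟨ R.*-cong (R.+-congˡ (R.-‿cong (dot≈0 a))) (factors≈1 as) ⟩
        (1# - 0#) * 1#                        ≈⟨ R.*-identityʳ _ ⟩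
        1# - 0#                               ≈⟨ R.+-congˡ -0#≈0# ⟩
        1# + 0#                               ≈⟨ R.+-identityʳ 1# ⟩
        1#                                    ∎

    -- Contrapositive of the covering property: a single form of value 1 annihilates its factor,
    -- hence the product.
    uncovered : ∀ {y t} (as : Vec (Vec Carrier n) t) → eval (covering as) y ≉ 1# →
                VecAll.All (λ a → dot a y ≉ 1#) as
    uncovered {y} as ≉1 = go as λ factors≈0 → ≉1 (begin-equality
        eval (covering as) y      ≈⟨ eval-covering as y ⟩
        1# - eval (factors as) y  ≈⟨ R.+-congˡ (R.-‿cong factors≈0) ⟩
        1# - 0#                   ≈⟨ R.+-congˡ -0#≈0# ⟩
        1# + 0#                   ≈⟨ R.+-identityʳ 1# ⟩
        1#                        ∎)
      where
      go : ∀ {t} (as : Vec (Vec Carrier n) t) → eval (factors as) y ≉ 0# → VecAll.All (λ a → dot a y ≉ 1#) as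
      go []       ≉0 = VecAll.[]
      go (a ∷ as) ≉0 =
        (λ dot≈1 → ≉0 (R.trans (eval-factors-∷ a as y)
          (R.trans (R.*-congʳ (x≈y⇒x∙y⁻¹≈ε (R.sym dot≈1))) (R.zeroˡ _)))) VecAll.∷
        go as (λ factors≈0 → ≉0 (R.trans (eval-factors-∷ a as y) (R.trans (R.*-congˡ factors≈0) (R.zeroʳ _))))

    -- The exponent vectors that are listed, including those whose
    -- coefficients cancel.
    TermsOfDegree≤ : ℕ → Pred (Poly n) 0ℓ
    TermsOfDegree≤ d = All λ t → Vec.sum (proj₂ t) ℕ.≤ d

    -- An exponent vector of degree above `d` matches no listed term of `Q`, so its coefficient
    -- there is an empty sum; `_≈ₚ_` transfers this to `P`.
    terms⇒degreeAtMost : ∀ {d} {P Q : Poly n} → P ≈ₚ Q → TermsOfDegree≤ d Q → DegreeAtMost d P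
    terms⇒degreeAtMost {d} {P} {Q} P≈Q Q≤d m coeff≉0 = ℕ.≮⇒≥ λ d<m → coeff≉0
      (R.trans (P≈Q m) (R.reflexive (cong (λ ts → List.foldr _+_ 0# (List.map proj₁ ts))
        (List.filter-none (λ t → ≡-dec ℕ._≟_ (proj₂ t) m)
          (All.map (λ { {a , k} k≤d refl → ℕ.<⇒≱ d<m k≤d }) Q≤d)))))

    sum-zipWith-+ : ∀ {l} (j k : Vec ℕ l) → Vec.sum (Vec.zipWith ℕ._+_ j k) ≡ Vec.sum j ℕ.+ Vec.sum k
    sum-zipWith-+ []      []      = refl
    sum-zipWith-+ (a ∷ j) (b ∷ k) rewrite sum-zipWith-+ j k = +-interchange a b (Vec.sum j) (Vec.sum k)

    terms-* : ∀ {d e} {P Q : Poly n} → TermsOfDegree≤ d P → TermsOfDegree≤ e Q → TermsOfDegree≤ (d ℕ.+ e) (P *ₚ Q)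
    terms-* {P = []} [] Q≤e = []
    terms-* {P = (a , k) ∷ P} (k≤d ∷ P≤d) Q≤e = All.++⁺
      (All.map⁺ (All.map (λ { {b , l} l≤e → subst (ℕ._≤ _) (≡.sym (sum-zipWith-+ k l)) (ℕ.+-mono-≤ k≤d l≤e) }) Q≤e))
      (terms-* P≤d Q≤e)

    sum-zeros : ∀ l → Vec.sum (Vec.replicate l 0) ≡ 0
    sum-zeros zero    = refl
    sum-zeros (suc l) = sum-zeros l

    terms-1 : ∀ {d} → TermsOfDegree≤ d 1ₚ
    terms-1 = subst (ℕ._≤ _) (≡.sym (sum-zeros n)) ℕ.z≤n ∷ []

    terms-- : ∀ {d} {P Q : Poly n} → TermsOfDegree≤ d P → TermsOfDegree≤ d Q → TermsOfDegree≤ d (P -ₚ Q)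
    terms-- P≤d Q≤d = All.++⁺ P≤d (All.map⁺ Q≤d)

    terms-linearForm : ∀ a → TermsOfDegree≤ 1 (linearForm a)
    terms-linearForm a = tabulated λ i → ℕ.≤-reflexive (sum-unit i)
      where
      sum-unit : ∀ {l} (i : Fin l) → Vec.sum (Vec.replicate l 0 Vec.[ i ]≔ 1) ≡ 1
      sum-unit {suc l} zero    = cong suc (sum-zeros l)
      sum-unit         (suc i) = sum-unit i
      tabulated : ∀ {l} {t : Fin l → Carrier × Vec ℕ n} → (∀ i → Vec.sum (proj₂ (t i)) ℕ.≤ 1) →
        TermsOfDegree≤ 1 (Vec.toList (Vec.tabulate t))
      tabulated {zero}  t≤1 = []
      tabulated {suc l} t≤1 = t≤1 zero ∷ tabulated (t≤1 ∘ suc)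

    terms-factors : ∀ {t} (as : Vec (Vec Carrier n) t) → TermsOfDegree≤ t (factors as)
    terms-factors []       = terms-1
    terms-factors (a ∷ as) = terms-* {P = 1ₚ -ₚ linearForm a} (terms-- terms-1 (terms-linearForm a)) (terms-factors as)

    -- Yields the first inequality of the theorem: a distribution witnessing the covering degree
    -- also witnesses the ordinary one.
    hyperplaneCovering⇒degree : ∀ {d} → HyperplaneCoveringAtMost d ⊆ DegreeAtMost d
    hyperplaneCovering⇒degree {d} {P} (t , t≤d , as , P≈covering) m coeff≉0 =
      ℕ.≤-trans (terms⇒degreeAtMost {P = P} {covering as} P≈covering (terms-- terms-1 (terms-factors as)) m coeff≉0) t≤d

-- The random forms, their hit probabilities and the resulting distribution.

module RandomCovering (dec : (P : Set) → Dec P) (ℝ : Reals) where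
  open Reals ℝ
  open Over ℝ
  open OrderedField ℝ
  open Counting dec
  open UniformMeasure dec ℝ
  open HyperplaneCovering ℝ
  open Arithmetic

  _[_] : ∀ {n} → Vec Carrier n → Vec Bool n → Carrier
  a [ x ] = dot a (Vec.map fromBool x)

  Misses : ∀ {n} → Vec Bool n → Pred (Vec Carrier n) 0ℓ
  Misses x a = a [ x ] ≉ 1#

  OR-false : ∀ {n} (x : Vec Bool n) → OR x ≡ false → ∀ a → a [ x ] ≈ 0#
  OR-false []          _  []      = R.refl
  OR-false (false ∷ x) or (c ∷ a) = R.trans (R.+-cong (R.zeroʳ c) (OR-false x or a)) (R.+-identityʳ 0#)

  OR-true : ∀ {n} (x : Vec Bool n) → OR x ≡ true → 1 ℕ.≤ weight x
  OR-true (false ∷ x) or = OR-true x or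
  OR-true (true  ∷ x) or = ℕ.s≤s ℕ.z≤n

  -- Each coefficient is 1 with probability 1 / suc p, and 0 otherwise.
  sparseForms : ℕ → ∀ n → List (Vec Carrier n)
  sparseForms p zero    = [] ∷ []
  sparseForms p (suc n) = List.cartesianProductWith _∷_ (1# ∷ List.replicate p 0#) (sparseForms p n)

  length-sparseForms : ∀ p n → List.length (sparseForms p n) ≡ suc p ℕ.^ n
  length-sparseForms p zero    = refl
  length-sparseForms p (suc n) = ≡.trans
    (length-cartesianProductWith _∷_ (1# ∷ List.replicate p 0#) (sparseForms p n))
    (cong₂ ℕ._*_ (cong suc (List.length-replicate p)) (length-sparseForms p n))

  count-sparseForms : ∀ {n} p (P : Pred (Vec Carrier (suc n)) 0ℓ) → count P (sparseForms p (suc n)) ≡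
    count (P ∘ (1# ∷_)) (sparseForms p n) ℕ.+ p ℕ.* count (P ∘ (0# ∷_)) (sparseForms p n)
  count-sparseForms {n} p P = ≡.trans (count-++ P (List.map (1# ∷_) (sparseForms p n)) _)
    (cong₂ ℕ._+_ (count-map P (1# ∷_) (sparseForms p n)) (zeros p))
    where
    zeros : ∀ q → count P (List.cartesianProductWith _∷_ (List.replicate q 0#) (sparseForms p n)) ≡
                  q ℕ.* count (P ∘ (0# ∷_)) (sparseForms p n)
    zeros zero    = refl
    zeros (suc q) = ≡.trans (count-++ P (List.map (0# ∷_) (sparseForms p n)) _)
      (cong₂ ℕ._+_ (count-map P (0# ∷_) (sparseForms p n)) (zeros q))

  Value : ∀ {l} → Carrier → Vec Bool l → Pred (Vec Carrier l) 0ℓ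
  Value c x a = a [ x ] ≈ c

  value-false : ∀ {l c} e {x : Vec Bool l} → Value c x ⊆ Value c (false ∷ x) ∘ (e ∷_)
  value-false e value = R.trans (R.+-cong (R.zeroʳ e) value) (R.+-identityˡ _)

  value-true₀ : ∀ {l c} {x : Vec Bool l} → Value c x ⊆ Value c (true ∷ x) ∘ (0# ∷_)
  value-true₀ value = R.trans (R.+-cong (R.zeroˡ 1#) value) (R.+-identityˡ _)

  value-true₁ : ∀ {l} {x : Vec Bool l} → Value 0# x ⊆ Value 1# (true ∷ x) ∘ (1# ∷_)
  value-true₁ value = R.trans (R.+-cong (R.*-identityˡ 1#) value) (R.+-identityʳ 1#)

  module _ (p : ℕ) where

    count-false : ∀ {l} c (x : Vec Bool l) →
      suc p ℕ.* count (Value c x) (sparseForms p l) ℕ.≤ count (Value c (false ∷ x)) (sparseForms p (suc l))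
    count-false {l} c x = subst (suc p ℕ.* count (Value c x) forms ℕ.≤_)
      (≡.sym (count-sparseForms p (Value c (false ∷ x))))
      (ℕ.+-mono-≤ (count-mono {P = Value c x} (λ {a} → value-false 1# {x} {a}) forms)
        (ℕ.*-monoʳ-≤ p (count-mono {P = Value c x} (λ {a} → value-false 0# {x} {a}) forms)))
      where forms = sparseForms p l

    -- Only lower bounds on the number of successful forms are wanted, so it suffices that a choice
    -- without hits has value 0, and below that a choice with one hit has value 1.
    zeroHits≤count : ∀ {l} (x : Vec Bool l) → zeroHits p x ℕ.≤ count (Value 0# x) (sparseForms p l)
    zeroHits≤count []          = ℕ.≤-trans (1≤indicator R.refl) (ℕ.m≤m+n _ _)
    zeroHits≤count (false ∷ x) = ℕ.≤-trans (ℕ.*-monoʳ-≤ (suc p) (zeroHits≤count x)) (count-false 0# x)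
    zeroHits≤count {suc l} (true ∷ x) = subst (p ℕ.* zeroHits p x ℕ.≤_)
      (≡.sym (count-sparseForms p (Value 0# (true ∷ x))))
      (ℕ.≤-trans (ℕ.*-monoʳ-≤ p (ℕ.≤-trans (zeroHits≤count x)
        (count-mono {P = Value 0# x} (λ {a} → value-true₀ {x = x} {a}) (sparseForms p l)))) (ℕ.m≤n+m _ _))

    oneHits≤count : ∀ {l} (x : Vec Bool l) → oneHits p x ℕ.≤ count (Value 1# x) (sparseForms p l)
    oneHits≤count []          = ℕ.z≤n
    oneHits≤count (false ∷ x) = ℕ.≤-trans (ℕ.*-monoʳ-≤ (suc p) (oneHits≤count x)) (count-false 1# x)
    oneHits≤count {suc l} (true ∷ x) = subst (zeroHits p x ℕ.+ p ℕ.* oneHits p x ℕ.≤_)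
      (≡.sym (count-sparseForms p (Value 1# (true ∷ x))))
      (ℕ.+-mono-≤
        (ℕ.≤-trans (zeroHits≤count x) (count-mono {P = Value 0# x} (λ {a} → value-true₁ {x = x} {a}) (sparseForms p l)))
        (ℕ.*-monoʳ-≤ p (ℕ.≤-trans (oneHits≤count x)
          (count-mono {P = Value 1# x} (λ {a} → value-true₀ {x = x} {a}) (sparseForms p l)))))

    sparseForms-hit : ∀ {n} (x : Vec Bool n) → 1 ℕ.≤ p → 2 ℕ.* weight x ℕ.≤ suc p → suc p ℕ.≤ 4 ℕ.* weight x →
      List.length (sparseForms p n) ℕ.≤ 8 ℕ.* count (∁ (Misses x)) (sparseForms p n)
    sparseForms-hit {n} x 1≤p 2w≤m m≤4w = begin
      List.length (sparseForms p n)                  ≡⟨ length-sparseForms p n ⟩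
      suc p ℕ.^ n                                    ≤⟨ oneHits-bound p x 1≤p 2w≤m m≤4w ⟩
      8 ℕ.* oneHits p x                              ≤⟨ ℕ.*-monoʳ-≤ 8 (oneHits≤count x) ⟩
      8 ℕ.* count (Value 1# x) (sparseForms p n)     ≤⟨ ℕ.*-monoʳ-≤ 8 (count-mono (λ v ¬v → ¬v v) (sparseForms p n)) ⟩
      8 ℕ.* count (∁ (Misses x)) (sparseForms p n)   ∎
      where open ℕ.≤-Reasoning

  module _ {n : ℕ} where

    -- Index `j` belongs to weight j + 1, which keeps the inverted number non-zero.
    meanForm : ℕ → Vec Carrier n
    meanForm j = Vec.replicate n (fromℕ (suc j) ⁻¹)

    dot-replicate : ∀ {l} c (x : Vec Bool l) → Vec.replicate l c [ x ] ≈ c * fromℕ (weight x)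
    dot-replicate c []          = R.sym (R.zeroʳ c)
    dot-replicate c (false ∷ x) = R.trans (R.+-cong (R.zeroʳ c) (dot-replicate c x)) (R.+-identityˡ _)
    dot-replicate c (true  ∷ x) = R.trans (R.+-congˡ (dot-replicate c x)) (R.sym (R.distribˡ c 1# (fromℕ (weight x))))

    meanForm-hit : ∀ {j} (x : Vec Bool n) → weight x ≡ suc j → meanForm j [ x ] ≈ 1#
    meanForm-hit {j} x w≡1+j = R.trans (dot-replicate _ x)
      (R.trans (R.*-congˡ (R.reflexive (cong fromℕ w≡1+j)))
        (R.trans (R.*-comm _ _) (⁻¹-inverse (0<fromℕ (suc j)))))

    meanTrial : ℕ → List (List (Vec Carrier n))
    meanTrial j = (meanForm j ∷ []) ∷ []

    -- Scale i is meant for the weights w from k 2^i to k 2^(i+1): the probability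
    -- 1 / (k 2^(i+2)) of a non-zero coefficient lies between 1/(4w) and 1/(2w).
    scaleTrials : ℕ → ℕ → ℕ → List (List (Vec Carrier n))
    scaleTrials k K i = List.replicate (K ℕ.* 7) (sparseForms (ℕ.pred (k ℕ.* 2 ℕ.^ suc (suc i))) n)

    randomForms : ℕ → ℕ → ℕ → List (List (Vec Carrier n))
    randomForms k K J = List.concat (List.applyUpTo meanTrial k)
                     ++ List.concat (List.applyUpTo (scaleTrials k K) J)

    length-randomForms : ∀ k K J → List.length (randomForms k K J) ≡ k ℕ.+ J ℕ.* (K ℕ.* 7)
    length-randomForms k K J = ≡.trans (List.length-++ (List.concat (List.applyUpTo meanTrial k)))
      (cong₂ ℕ._+_ (≡.trans (length-concat-applyUpTo meanTrial (λ _ → refl) k) (ℕ.*-identityʳ k))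
                   (length-concat-applyUpTo _ (λ _ → List.length-replicate (K ℕ.* 7)) J))

    tuples-nonempty : ∀ k K J → NonZero (List.length (tuples (randomForms k K J)))
    tuples-nonempty k K J = subst NonZero (≡.sym (length-tuples (randomForms k K J)))
      (ℕ-List.product≢0 (All.map⁺ (All.++⁺
        (All.concat⁺ (All.applyUpTo⁺₂ _ k λ j → _ ∷ []))
        (All.concat⁺ (All.applyUpTo⁺₂ _ J λ i → All.replicate⁺ (K ℕ.* 7) (nonempty i))))))
      where
      nonempty : ∀ i → NonZero (List.length (sparseForms (ℕ.pred (k ℕ.* 2 ℕ.^ suc (suc i))) n))
      nonempty i = subst NonZero (≡.sym (length-sparseForms p n)) (ℕ.m^n≢0 (suc p) n)
        where p = ℕ.pred (k ℕ.* 2 ℕ.^ suc (suc i))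

    meanTrial-avoid : ∀ c {j} (x : Vec Bool n) → weight x ≡ suc j → AvoidsUpTo c (Misses x) (meanTrial j)
    meanTrial-avoid c {j} x w≡1+j = avoids-surely {P = Misses x} c {meanForm j ∷ []}
      (count-none {P = Misses x} {meanForm j ∷ []} ((λ miss → miss (meanForm-hit x w≡1+j)) ∷ []))

    scaleTrials-avoid : ∀ {k i} K (x : Vec Bool n) → 1 ℕ.≤ weight x →
      k ℕ.* 2 ℕ.^ i ℕ.≤ weight x → weight x ℕ.< k ℕ.* 2 ℕ.^ suc i →
      AvoidsUpTo (2 ℕ.^ K) (Misses x) (scaleTrials k K i)
    scaleTrials-avoid {k} {i} K x 1≤w lo hi = avoids-replicate
      (sparseForms-hit p x 1≤p (subst (2 ℕ.* w ℕ.≤_) (≡.sym 1+p≡m) 2w≤m) (subst (ℕ._≤ 4 ℕ.* w) (≡.sym 1+p≡m) m≤4w)) K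
      where
      open ℕ.≤-Reasoning
      w = weight x
      m = k ℕ.* 2 ℕ.^ suc (suc i)
      p = ℕ.pred m
      double : ∀ k t → 2 ℕ.* (k ℕ.* t) ≡ k ℕ.* (2 ℕ.* t)
      double = solve-∀
      quadruple : ∀ k t → k ℕ.* (2 ℕ.* (2 ℕ.* t)) ≡ 4 ℕ.* (k ℕ.* t)
      quadruple = solve-∀
      2w≤m : 2 ℕ.* w ℕ.≤ m
      2w≤m = begin
        2 ℕ.* w                     ≤⟨ ℕ.*-monoʳ-≤ 2 (ℕ.<⇒≤ hi) ⟩
        2 ℕ.* (k ℕ.* 2 ℕ.^ suc i)   ≡⟨ double k (2 ℕ.^ suc i) ⟩
        m                           ∎
      m≤4w : m ℕ.≤ 4 ℕ.* w
      m≤4w = begin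
        m                           ≡⟨ quadruple k (2 ℕ.^ i) ⟩
        4 ℕ.* (k ℕ.* 2 ℕ.^ i)       ≤⟨ ℕ.*-monoʳ-≤ 4 lo ⟩
        4 ℕ.* w                     ∎
      -- This makes `p` positive and lets `suc` undo the `pred` in its definition.
      2≤m : 2 ℕ.≤ m
      2≤m = ℕ.≤-trans (ℕ.*-monoʳ-≤ 2 1≤w) 2w≤m
      1≤p : 1 ℕ.≤ p
      1≤p = ℕ.pred-mono-≤ 2≤m
      1+p≡m : suc p ≡ m
      1+p≡m = ℕ.suc-pred m {{ℕ.>-nonZero (ℕ.≤-trans (ℕ.s≤s ℕ.z≤n) 2≤m)}}

    randomForms-avoid : ∀ {k} K J → 1 ℕ.≤ k → (k ℕ.< n → n ℕ.< k ℕ.* 2 ℕ.^ J) →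
      ∀ x → OR x ≡ true → AvoidsUpTo (2 ℕ.^ K) (Misses x) (randomForms k K J)
    randomForms-avoid {k} K J 1≤k n<k2^J x or with weight x ℕ.≤? k
    ... | yes w≤k = subst (λ c → AvoidsUpTo c (Misses x) (randomForms k K J)) (ℕ.*-identityʳ (2 ℕ.^ K))
      (avoids-++ {c = 2 ℕ.^ K} {1} (List.concat (List.applyUpTo meanTrial k))
        (avoids-concat (2 ℕ.^ K) meanTrial pw<k (meanTrial-avoid (2 ℕ.^ K) x (≡.sym 1+pw≡w)))
        (avoids-1 (List.concat (List.applyUpTo (scaleTrials k K) J))))
      where
      1+pw≡w : suc (ℕ.pred (weight x)) ≡ weight x
      1+pw≡w = ℕ.suc-pred (weight x) {{ℕ.>-nonZero (OR-true x or)}}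
      pw<k : ℕ.pred (weight x) ℕ.< k
      pw<k = subst (ℕ._≤ k) (≡.sym 1+pw≡w) w≤k
    ... | no w≰k with k<w ← ℕ.≰⇒> w≰k with dyadicScale k (weight x) 1≤k (ℕ.<⇒≤ k<w)
    ...   | i , lo , hi = subst (λ c → AvoidsUpTo c (Misses x) (randomForms k K J)) (ℕ.*-identityˡ (2 ℕ.^ K))
      (avoids-++ {c = 1} {2 ℕ.^ K} (List.concat (List.applyUpTo meanTrial k))
        (avoids-1 (List.concat (List.applyUpTo meanTrial k)))
        (avoids-concat (2 ℕ.^ K) (scaleTrials k K) i<J (scaleTrials-avoid {k} {i} K x (OR-true x or) lo hi)))
      where
      i<J : i ℕ.< J
      i<J = ℕ.≰⇒> λ J≤i → ℕ.<⇒≱ (n<k2^J (ℕ.<-≤-trans k<w (weight≤n x)))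
        (ℕ.≤-trans (ℕ.*-monoʳ-≤ k (ℕ.^-monoʳ-≤ 2 J≤i)) (ℕ.≤-trans lo (weight≤n x)))

    -- The uniform distribution on tuples of forms is pushed forward along `covering`. An error at a
    -- non-zero input means that all drawn forms miss, which happens with probability at most 2^-K ≤
    -- ε.
    coveringDistribution : ∀ {ε} K → 0# < ε → ε ⁻¹ ≤ fromℕ 2 ^ K →
      ∀ (Fs : List (List (Vec Carrier n))) → NonZero (List.length (tuples Fs)) →
      (∀ x → OR x ≡ true → AvoidsUpTo (2 ℕ.^ K) (Misses x) Fs) →
      Σ (ProbabilityMeasure (Poly n)) λ 𝐏 →
        IsProbabilisticPolynomial ε OR 𝐏 ×
        ProbabilityMeasure.SupportedOn 𝐏 (HyperplaneCoveringAtMost (List.length Fs))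
    coveringDistribution {ε} K 0<ε ε⁻¹≤2^K Fs nonempty avoids =
      uniform polys , (λ x → _ , frequency≤ {xs = polys} (error≤ x)) ,
      -- All predicates being measurable, the supporting set serves as its own event of probability
      -- one.
      HyperplaneCoveringAtMost (List.length Fs) , _ , id , supported
      where
      open import Relation.Binary.Reasoning.PartialOrder poset
      polys : List (Poly n)
      polys = List.map covering (tuples Fs)
      N≡ : List.length polys ≡ List.length (tuples Fs)
      N≡ = List.length-map covering (tuples Fs)
      instance
        N≢0 : NonZero (List.length polys)
        N≢0 = subst NonZero (≡.sym N≡) nonempty

      supported : frequency polys (HyperplaneCoveringAtMost (List.length Fs)) ≈ 1#
      supported = R.trans (R.*-congʳ (R.reflexive (cong fromℕ (count-all
        (All.map⁺ (All.universal (λ as → List.length Fs , ℕ.≤-refl , as , λ _ → R.refl) (tuples Fs)))))))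
        (⁻¹-inverse (0<fromℕ (List.length polys)))

      errors : ∀ x b → OR x ≡ b → 2 ℕ.^ K ℕ.* count (ErrorAt ε OR x) polys ℕ.≤ List.length polys
      errors x false or = ℕ.≤-trans (ℕ.*-monoʳ-≤ (2 ℕ.^ K) (count-none (All.map⁺ (All.universal
              (λ as error → error (R.trans (covering-vanishes {y = Vec.map fromBool x} (OR-false x or) as)
                (R.reflexive (cong fromBool (≡.sym or))))) (tuples Fs)))))
              (ℕ.≤-trans (ℕ.≤-reflexive (ℕ.*-zeroʳ (2 ℕ.^ K))) ℕ.z≤n)
      errors x true or = E.begin
              2 ℕ.^ K ℕ.* count (ErrorAt ε OR x) polys
                E.≡⟨ cong (2 ℕ.^ K ℕ.*_) (count-map (ErrorAt ε OR x) covering (tuples Fs)) ⟩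
              2 ℕ.^ K ℕ.* count (ErrorAt ε OR x ∘ covering) (tuples Fs)
                E.≤⟨ ℕ.*-monoʳ-≤ (2 ℕ.^ K) (ℕ.≤-trans
                      (count-mono {P = ErrorAt ε OR x ∘ covering} (λ {as} → missed {as}) (tuples Fs))
                      (count-tuples (Misses x) Fs)) ⟩
              2 ℕ.^ K ℕ.* product (List.map (count (Misses x)) Fs)
                E.≤⟨ avoids x or ⟩
              product (List.map List.length Fs)
                E.≡⟨ ≡.trans N≡ (length-tuples Fs) ⟨
              List.length polys E.∎
              where
              module E = ℕ.≤-Reasoning
              missed : ErrorAt ε OR x ∘ covering ⊆ VecAll.All (Misses x)
              missed {as} error = uncovered {y = Vec.map fromBool x} as λ ≈1 →
                error (R.trans ≈1 (R.reflexive (cong fromBool (≡.sym or))))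

      error≤ : ∀ x → fromℕ (count (ErrorAt ε OR x) polys) ≤ ε * fromℕ (List.length polys)
      error≤ x = begin
        b                       ≈⟨ R.*-identityˡ b ⟨
        1# * b                  ≈⟨ R.*-congʳ (⁻¹-inverse 0<ε) ⟨
        (ε * ε ⁻¹) * b          ≈⟨ R.*-assoc ε (ε ⁻¹) b ⟩
        ε * (ε ⁻¹ * b)          ≤⟨ *-monoˡ-≤ (proj₁ 0<ε) (*-monoʳ-≤ (0≤fromℕ (count (ErrorAt ε OR x) polys)) ε⁻¹≤2^K) ⟩
        ε * (fromℕ 2 ^ K * b)   ≈⟨ R.*-congˡ (R.*-congʳ (fromℕ-homo-^ 2 K)) ⟨
        ε * (fromℕ (2 ℕ.^ K) * b)
          ≈⟨ R.*-congˡ (fromℕ-homo-* (2 ℕ.^ K) _) ⟨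
        ε * fromℕ (2 ℕ.^ K ℕ.* count (ErrorAt ε OR x) polys)
          ≤⟨ *-monoˡ-≤ (proj₁ 0<ε) (fromℕ-mono-≤ (errors x _ refl)) ⟩
        ε * fromℕ (List.length polys) ∎
        where b = fromℕ (count (ErrorAt ε OR x) polys)

-- Comparing the number of forms with the logarithm of the binomial sum.

module DegreeBound (dec : (P : Set) → Dec P) (ℝ : Reals) where
  open Reals ℝ
  open Over ℝ
  open OrderedField ℝ
  open RandomCovering dec ℝ
  open Arithmetic

  -- The indices 0 to `k` all pass the filter, and extending the range from `k` to `N` only adds
  -- natural numbers.
  binomialSum≤binom≤ : ∀ {N k α} → k ℕ.≤ N → fromℕ k ≤ α → binomialSum N k ℕ.≤ binom≤ N α
  binomialSum≤binom≤ {N} {k} {α} k≤N k≤α = ℕ.≤-trans (go k k≤α) (partial-mono (ℕ.≤⇒≤′ (ℕ.s≤s k≤N)))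
    where
    open ℕ.≤-Reasoning
    P? : Decidable (λ i → fromℕ i ≤ α)
    P? i = fromℕ i ≤? α
    sumOver : List ℕ → ℕ
    sumOver is = ℕ-List.sum (List.map (N C_) (List.filter P? is))
    partial : ℕ → ℕ
    partial m = sumOver (List.upTo m)
    partial-suc : ∀ m → partial (suc m) ≡ partial m ℕ.+ sumOver (m ∷ [])
    partial-suc m = ≡.trans (cong sumOver (≡.sym (List.upTo-∷ʳ m)))
      (≡.trans (cong (ℕ-List.sum ∘ List.map (N C_)) (List.filter-++ P? (List.upTo m) (m ∷ [])))
        (≡.trans (cong ℕ-List.sum (List.map-++ (N C_) (List.filter P? (List.upTo m)) _))
          (ℕ-List.sum-++ (List.map (N C_) (List.filter P? (List.upTo m))) _)))
    partial-mono : ∀ {l m} → l ℕ.≤′ m → partial l ℕ.≤ partial m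
    partial-mono ℕ.≤′-refl        = ℕ.≤-refl
    partial-mono (ℕ.≤′-step {m} l≤m) = ℕ.≤-trans (partial-mono l≤m)
      (ℕ.≤-trans (ℕ.m≤m+n _ _) (ℕ.≤-reflexive (≡.sym (partial-suc m))))
    include : ∀ {m} → fromℕ m ≤ α → N C m ℕ.+ partial m ≡ partial (suc m)
    include {m} m≤α = begin-equality
      N C m ℕ.+ partial m             ≡⟨ ℕ.+-comm (N C m) (partial m) ⟩
      partial m ℕ.+ N C m             ≡⟨ cong (partial m ℕ.+_) (ℕ.+-identityʳ (N C m)) ⟨
      partial m ℕ.+ (N C m ℕ.+ 0)     ≡⟨ cong (λ is → partial m ℕ.+ ℕ-List.sum (List.map (N C_) is))
                                             (List.filter-accept P? m≤α) ⟨
      partial m ℕ.+ sumOver (m ∷ [])  ≡⟨ partial-suc m ⟨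
      partial (suc m)                 ∎
    go : ∀ m → fromℕ m ≤ α → binomialSum N m ℕ.≤ partial (suc m)
    go zero    0≤α   = ℕ.≤-reflexive (include 0≤α)
    go (suc m) 1+m≤α = begin
      N C suc m ℕ.+ binomialSum N m   ≤⟨ ℕ.+-monoʳ-≤ _ (go m (≤.trans (fromℕ-mono-≤ (ℕ.n≤1+n m)) 1+m≤α)) ⟩
      N C suc m ℕ.+ partial (suc m)   ≡⟨ include 1+m≤α ⟩
      partial (suc (suc m))           ∎

  s≤log₂-fromℕ : ∀ {s B} → 2 ℕ.^ s ℕ.≤ B → fromℕ s ≤ log₂ (fromℕ B)
  s≤log₂-fromℕ {s} {B} 2^s≤B = fromℕ≤log₂ s B
    (≤.trans (≤.reflexive (R.sym (fromℕ-homo-^ 2 s))) (fromℕ-mono-≤ 2^s≤B))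
    -- The cap only has to bound the set defining `log₂`, so the crude B ≤ 2^B will do.
    (≤.trans (fromℕ-mono-≤ (m≤2^m B)) (≤.reflexive (fromℕ-homo-^ 2 B)))

  -- The last scale needed is that of `n` itself, hence one more scale than its index. The constant
  -- is 29 = 1 + 2 · 2 · 7: one `M * k` for the mean forms, and for the random ones at most 2M
  -- scales of at most 2k blocks of seven.
  coveringSize : ∀ {n k} K → k ℕ.≤ n → 1 ℕ.≤ k → K ℕ.≤ 2 ℕ.* k →
    ∃ λ J → ∃ λ s → (k ℕ.< n → n ℕ.< k ℕ.* 2 ℕ.^ J) ×
      k ℕ.+ J ℕ.* (K ℕ.* 7) ℕ.≤ 29 ℕ.* s × 2 ℕ.^ s ℕ.≤ binomialSum n k
  coveringSize {n} {k} K k≤n 1≤k K≤2k with dyadicScale k n 1≤k k≤n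
  ... | J , lo , hi = suc J , M ℕ.* k , (λ _ → hi) , size , (begin
    2 ℕ.^ (M ℕ.* k)         ≡⟨ ℕ.^-*-assoc 2 M k ⟨
    (2 ℕ.^ M) ℕ.^ k         ≤⟨ ℕ.^-monoˡ-≤ k (2^M≤ J) ⟩
    suc (2 ℕ.^ J) ℕ.^ k     ≤⟨ [1+q]^k≤binomialSum (2 ℕ.^ J) k lo ⟩
    binomialSum n k         ∎)
    where
    open ℕ.≤-Reasoning
    -- For J = 0 the lower bound (1 + 2^J)^k is still 2^k; the maximum with 1 records this, so that
    -- the estimate survives when n < 2k.
    M = 1 ℕ.⊔ J
    2^M≤ : ∀ J → 2 ℕ.^ (1 ℕ.⊔ J) ℕ.≤ suc (2 ℕ.^ J)
    2^M≤ zero    = ℕ.≤-refl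
    2^M≤ (suc J) = ℕ.n≤1+n _
    regroup : ∀ M k → M ℕ.* k ℕ.+ 2 ℕ.* M ℕ.* (2 ℕ.* k ℕ.* 7) ≡ 29 ℕ.* (M ℕ.* k)
    regroup = solve-∀
    size : k ℕ.+ suc J ℕ.* (K ℕ.* 7) ℕ.≤ 29 ℕ.* (M ℕ.* k)
    size = begin
      k ℕ.+ suc J ℕ.* (K ℕ.* 7)
        ≤⟨ ℕ.+-mono-≤ (ℕ.m≤n*m k M {{ℕ.>-nonZero (ℕ.m≤m⊔n 1 J)}})
             (ℕ.*-mono-≤ 1+J≤2M (ℕ.*-monoˡ-≤ 7 K≤2k)) ⟩
      M ℕ.* k ℕ.+ 2 ℕ.* M ℕ.* (2 ℕ.* k ℕ.* 7)  ≡⟨ regroup M k ⟩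
      29 ℕ.* (M ℕ.* k)                          ∎
      where
      1+J≤2M : suc J ℕ.≤ 2 ℕ.* M
      1+J≤2M = ℕ.≤-trans (ℕ.+-mono-≤ (ℕ.m≤m⊔n 1 J) (ℕ.m≤n⊔m 1 J))
        (ℕ.≤-reflexive (cong (M ℕ.+_) (≡.sym (ℕ.+-identityʳ M))))

  -- The least exponent K with 1/ε ≤ 2^K exists by the Archimedean property. It is at least 2, since
  -- 1/ε ≤ 2 and ε ≤ 1/3 would give 3 ≤ 2; minimality then bounds 2^(K-1) by 1/ε.
  errorExponent : ∀ {ε} → 0# < ε → ε < fromℕ 3 ⁻¹ →
    ∃ λ k → 1 ℕ.≤ k × fromℕ 2 ^ k ≤ ε ⁻¹ × ε ⁻¹ ≤ fromℕ 2 ^ suc k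
  errorExponent {ε} 0<ε (ε≤1/3 , _) = predecessor (least (λ j → ε ⁻¹ ≤? fromℕ 2 ^ j) {N} ε⁻¹≤2^N)
    where
    open import Relation.Binary.Reasoning.PartialOrder poset
    N = proj₁ (archimedean dec (ε ⁻¹))
    ε⁻¹≤2^N : ε ⁻¹ ≤ fromℕ 2 ^ N
    ε⁻¹≤2^N = ≤.trans (proj₂ (archimedean dec (ε ⁻¹)))
      (≤.trans (fromℕ-mono-≤ (m≤2^m N)) (≤.reflexive (fromℕ-homo-^ 2 N)))

    ε⁻¹≰2 : ¬ ε ⁻¹ ≤ fromℕ 2
    ε⁻¹≰2 ε⁻¹≤2 = ℕ.<⇒≱ (ℕ.n<1+n 2) (fromℕ-cancel-≤ {3} {2} (begin
      fromℕ 3                           ≈⟨ R.*-identityʳ (fromℕ 3) ⟨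
      fromℕ 3 * 1#                      ≈⟨ R.*-congˡ (⁻¹-inverse 0<ε) ⟨
      fromℕ 3 * (ε * ε ⁻¹)              ≤⟨ *-monoˡ-≤ (0≤fromℕ 3) (*-monoˡ-≤ (proj₁ 0<ε) ε⁻¹≤2) ⟩
      fromℕ 3 * (ε * fromℕ 2)           ≤⟨ *-monoˡ-≤ (0≤fromℕ 3) (*-monoʳ-≤ (0≤fromℕ 2) ε≤1/3) ⟩
      fromℕ 3 * (fromℕ 3 ⁻¹ * fromℕ 2)  ≈⟨ R.*-assoc (fromℕ 3) _ (fromℕ 2) ⟨
      (fromℕ 3 * fromℕ 3 ⁻¹) * fromℕ 2  ≈⟨ R.*-congʳ (⁻¹-inverse (0<fromℕ 3)) ⟩
      1# * fromℕ 2                      ≈⟨ R.*-identityˡ (fromℕ 2) ⟩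
      fromℕ 2                           ∎))

    predecessor : (∃ λ K → ε ⁻¹ ≤ fromℕ 2 ^ K × (∀ j → ε ⁻¹ ≤ fromℕ 2 ^ j → K ℕ.≤ j)) →
      ∃ λ k → 1 ℕ.≤ k × fromℕ 2 ^ k ≤ ε ⁻¹ × ε ⁻¹ ≤ fromℕ 2 ^ suc k
    predecessor (0 , ε⁻¹≤1 , _) = contradiction
      (≤.trans ε⁻¹≤1 (≤.trans (≤.reflexive (R.sym (R.+-identityʳ 1#))) (fromℕ-mono-≤ {1} {2} (ℕ.s≤s ℕ.z≤n)))) ε⁻¹≰2
    predecessor (1 , ε⁻¹≤2^1 , _) = contradiction (≤.trans ε⁻¹≤2^1 (≤.reflexive (R.*-identityʳ (fromℕ 2)))) ε⁻¹≰2
    predecessor (suc k@(suc _) , ε⁻¹≤2^K , minimal) = k , ℕ.s≤s ℕ.z≤n ,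
      [ id , (λ ε⁻¹≤2^k → contradiction (minimal k ε⁻¹≤2^k) (ℕ.<⇒≱ (ℕ.n<1+n k))) ]′ (≤.total (fromℕ 2 ^ k) (ε ⁻¹)) ,
      ε⁻¹≤2^K

  HasHCPDistribution : ℕ → Carrier → ℕ → Set₁
  HasHCPDistribution n ε d = Σ (ProbabilityMeasure (Poly n)) λ 𝐏 →
    IsProbabilisticPolynomial ε OR 𝐏 × ProbabilityMeasure.SupportedOn 𝐏 (HyperplaneCoveringAtMost d)

  HCPBound : ℕ → Carrier → Set₁
  HCPBound n ε = ∃ λ d → HasHCPDistribution n ε d × fromℕ d ≤ fromℕ 29 * log₂ (fromℕ (binom≤ n (log₂ (ε ⁻¹))))

  module _ (n : ℕ) .{{_ : NonZero n}} {ε : Carrier} (0<ε : 0# < ε) (k : ℕ) (1≤k : 1 ℕ.≤ k)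
           (2^k≤ε⁻¹ : fromℕ 2 ^ k ≤ ε ⁻¹) (ε⁻¹≤2^1+k : ε ⁻¹ ≤ fromℕ 2 ^ suc k) where
    open import Relation.Binary.Reasoning.PartialOrder poset
    L = log₂ (ε ⁻¹)

    -- The number `κ` of mean forms is kept apart from `k`, which fixes the error: it is `k` when
    -- that is at most `n`, and `n` otherwise.
    distribution : ∀ κ J → 1 ℕ.≤ κ → (κ ℕ.< n → n ℕ.< κ ℕ.* 2 ℕ.^ J) →
      HasHCPDistribution n ε (κ ℕ.+ J ℕ.* (suc k ℕ.* 7))
    distribution κ J 1≤κ n< = subst (HasHCPDistribution n ε) (length-randomForms {n} κ (suc k) J)
      (coveringDistribution (suc k) 0<ε ε⁻¹≤2^1+k (randomForms κ (suc k) J)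
        (tuples-nonempty {n} κ (suc k) J) (randomForms-avoid (suc k) J 1≤κ n<))

    bound : ∀ {d s κ} → κ ℕ.≤ k → κ ℕ.≤ n → d ℕ.≤ 29 ℕ.* s → 2 ℕ.^ s ℕ.≤ binomialSum n κ →
      fromℕ d ≤ fromℕ 29 * log₂ (fromℕ (binom≤ n L))
    bound {d} {s} {κ} κ≤k κ≤n d≤29s 2^s≤ = begin
      fromℕ d                                     ≤⟨ fromℕ-mono-≤ {d} {29 ℕ.* s} d≤29s ⟩
      fromℕ (29 ℕ.* s)                            ≈⟨ fromℕ-homo-* 29 s ⟩
      fromℕ 29 * fromℕ s                          ≤⟨ *-monoˡ-≤ (0≤fromℕ 29)
        (s≤log₂-fromℕ {s} (ℕ.≤-trans 2^s≤ (binomialSum≤binom≤ κ≤n κ≤L))) ⟩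
      fromℕ 29 * log₂ (fromℕ (binom≤ n L))        ∎
      where
      κ≤L : fromℕ κ ≤ L
      κ≤L = ≤.trans (fromℕ-mono-≤ κ≤k) (fromℕ≤log₂ k (suc k) 2^k≤ε⁻¹ ε⁻¹≤2^1+k)

    small : k ℕ.≤ n → HCPBound n ε
    small k≤n =
      let J , s , n< , d≤29s , 2^s≤ = coveringSize (suc k) k≤n 1≤k (ℕ.+-mono-≤ 1≤k (ℕ.m≤m+n k 0)) in
      k ℕ.+ J ℕ.* (suc k ℕ.* 7) , distribution k J 1≤k n< ,
      bound {k ℕ.+ J ℕ.* (suc k ℕ.* 7)} {s} {k} ℕ.≤-refl k≤n d≤29s 2^s≤

    large : n ℕ.≤ k → HCPBound n ε
    -- With `J = 0` there are no random sums, since no weight exceeds `n`.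
    large n≤k = n ℕ.+ 0 , distribution n 0 (ℕ.>-nonZero⁻¹ n) (λ n<n → contradiction n<n (ℕ.n≮n n)) ,
      bound {n ℕ.+ 0} {n} {n} n≤k ℕ.≤-refl (ℕ.≤-trans (ℕ.≤-reflexive (ℕ.+-identityʳ n)) (ℕ.m≤n*m n 29))
        -- Blocks of one element: the full binomial sum is at least 2^n, which pays for `n` forms.
        ([1+q]^k≤binomialSum 1 n (ℕ.≤-reflexive (ℕ.*-identityʳ n)))

  hcpUpperBound : ∀ n .{{_ : NonZero n}} {ε} → 0# < ε → ε < fromℕ 3 ⁻¹ → HCPBound n ε
  hcpUpperBound n 0<ε ε<1/3 =
    let k , 1≤k , 2^k≤ε⁻¹ , ε⁻¹≤2^1+k = errorExponent 0<ε ε<1/3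
    in [ small n 0<ε k 1≤k 2^k≤ε⁻¹ ε⁻¹≤2^1+k , large n 0<ε k 1≤k 2^k≤ε⁻¹ ε⁻¹≤2^1+k ]′ (ℕ.≤-total k n)

theorem3p2 :
    ExcludedMiddle (Level.suc 0ℓ) →
    (ℝ : Reals) →
    let open Reals ℝ
        open Over ℝ
    in
    ∃ λ (C : Carrier) →
      0# < C ×
      ((n : ℕ) .{{_ : NonZero n}} (ε : Carrier) →
       0# < ε →
       ε < fromℕ 3 ⁻¹ →
       ∃ λ (p : ℕ) →
       ∃ λ (h : ℕ) →
         IsPDeg ε (OR {n}) p ×
         IsHCPDeg ε (OR {n}) h ×
         p ℕ.≤ h ×
         fromℕ h ≤ C * log₂ (fromℕ (binom≤ n (log₂ (ε ⁻¹)))))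
theorem3p2 em ℝ = fromℕ 29 , 0<fromℕ 29 , λ n ε 0<ε ε<1/3 →
  let d , hcp-d , d≤ = hcpUpperBound n 0<ε ε<1/3
      -- The least degrees exist because some degree works. Excluded middle is invoked one level up,
      -- as the existence of a distribution is a statement in `Set₁`.
      h , hcp-h , h-least = least (λ _ → em) hcp-d
      p , pdeg-p , p-least = least (λ _ → em) (hcp⇒pdeg hcp-h)
  in p , h , (pdeg-p , p-least) , (hcp-h , h-least) , p-least h (hcp⇒pdeg hcp-h) ,
     ≤.trans (fromℕ-mono-≤ (h-least d hcp-d)) d≤
  where
  dec : (P : Set) → Dec P
  dec P = Dec.map′ lower lift (em {Lift _ P})
  open Reals ℝ
  open Over ℝ
  open OrderedField ℝ
  open HyperplaneCovering ℝ
  open DegreeBound dec ℝ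
  hcp⇒pdeg : ∀ {n ε d} → HasHCPDistribution n ε d → Σ (ProbabilityMeasure (Poly n)) λ 𝐏 →
    IsProbabilisticPolynomial ε OR 𝐏 × ProbabilityMeasure.SupportedOn 𝐏 (DegreeAtMost d)
  hcp⇒pdeg (𝐏 , correct , A , A-measurable , A⊆hcp , PrA≈1) =
    𝐏 , correct , A , A-measurable , (λ {P} → hyperplaneCovering⇒degree {x = P} ∘ A⊆hcp) , PrA≈1
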